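{- Let $M$ be a matroid. The $\mathcal{G}$-invariant of $M$ can be reconstructed from the deck $\{\mathcal{G}(M|X):X\text{ a copoint of }M\}$. Dually, $\mathcal{G}(M)$ can be reconstructed from the deck $\{\mathcal{G}(M/Y):Y\text{ a circuit of }M\}$.
   Context: Matroids are on finite sets. A copoint of $M$ is a flat of rank $r(M)-1$. $M|X$ is restriction and $M/Y$ is contraction. Decks are unlabeled multisets: for each copoint (resp. circuit) one records only the $\mathcal{G}$-invariant, with multiplicity; the size of the ground set of $M$ is not given. "Can be reconstructed from the deck" means is determined by the deck. $\mathcal{G}(n,r)$ is the vector space over a field of characteristic zero with basis the formal symbols $[\underline{r}]$, one for each $0,1$-sequence of length $n$ with exactly $r$ ones. For a rank-$r$ matroid $M$ with rank function $r(\cdot)$ on an $n$-element set $E$ and a permutation (linear ordering) $\pi$ of $E$, the rank sequence $\underline{r}(\pi)=r_1\ldots r_n$ has $r_1=r(\{\pi(1)\})$ and $r_j=r(\{\pi(1),\ldots,\pi(j)\})-r(\{\pi(1),\ldots,\pi(j-1)\})$ for $j\ge2$. The $\mathcal{G}$-invariant is $\mathcal{G}(M)=\sum_\pi[\underline{r}(\pi)]\in\mathcal{G}(n,r)$, over all $n!$ permutations of $E$.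
   Formalization: The copoint part assumes M has rank at least 2 and the circuit part assumes nullity at least 2; since the size of M is not given, the claim fails for every M excluded (e.g. U_{1,1} and U_{1,2} have equal copoint decks; U_{0,1} and U_{1,2} equal circuit decks). -}

module Defs where

open import Level using (_⊔_)
open import Algebra.Apartness.Bundles
  using (HeytingField; module HeytingCommutativeRing)
open import Algebra.Bundles using (module CommutativeRing)
import Algebra.Definitions.RawMonoid as RawMonoidDefinitions
open import Data.Bool.Base using (if_then_else_)
open import Data.Fin.Base using (Fin; zero; suc; toℕ)
open import Data.Fin.Patterns using (0F; 1F)
import Data.Fin.Properties as Fin
open import Data.Fin.Subset
open import Data.Fin.Subset.Properties
open import Data.List.Base as List
  using (List; []; _∷_; _++_; map; concatMap; filter; foldr; allFin)
import Data.List.Membership.Propositional as List∈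
open import Data.List.Membership.Propositional.Properties
  using (∈-concatMap⁻; ∈-map⁻; ∈-filter⁻)
open import Data.List.Properties using (≡-dec)
open import Data.List.Relation.Unary.All using (reduce)
open import Data.List.Relation.Unary.All.Properties using (all-filter)
open import Data.List.Relation.Unary.Any using (here; there)
open import Data.Nat.Base using (ℕ; zero; suc; _+_; _∸_; _≤_; s≤s)
import Data.Nat.Properties as ℕ
open import Algebra.Properties.CommutativeSemigroup ℕ.+-commutativeSemigroup
  using (interchange)
open import Data.Product.Base using (∃; _×_; _,_; proj₁; proj₂)
open import Data.Sum.Base using (inj₁; inj₂; [_,_]′)
open import Data.Vec.Base as Vec using (Vec; []; _∷_; count; here; there)
open import Function.Base using (_∘_; id)
open import Relation.Binary.Bundles using (Setoid)
open import Relation.Binary.PropositionalEquality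
  using (_≡_; refl; sym; trans; cong; cong₂; subst; module ≡-Reasoning)
open import Relation.Nullary.Decidable
  using (yes; no; does; map′; ¬?; _×-dec_; _→-dec_; decidable-stable)
open import Relation.Nullary.Negation using (¬_; contradiction)
open import Relation.Unary using (Decidable)

private
  variable
    m n r : ℕ

-- The ground set is a subset E of some Fin m, so that minors need no
-- relabelling.  Values of rank on sets not contained in E are irrelevant.

record Matroid (m : ℕ) : Set where
  field
    E          : Subset m
    rank       : Subset m → ℕ
    rank≤size  : ∀ {A} → A ⊆ E → rank A ≤ ∣ A ∣
    monotone   : ∀ {A B} → A ⊆ B → B ⊆ E → rank A ≤ rank B
    submodular : ∀ {A B} → A ⊆ E → B ⊆ E →
                 rank (A ∪ B) + rank (A ∩ B) ≤ rank A + rank B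

  size : ℕ
  size = ∣ E ∣

  matroidRank : ℕ
  matroidRank = rank E

  Independent : Subset m → Set
  Independent A = A ⊆ E × rank A ≡ ∣ A ∣

  IsFlat : Subset m → Set
  IsFlat X = X ⊆ E × (∀ x → x ∈ E → rank (X ∪ ⁅ x ⁆) ≡ rank X → x ∈ X)

  IsCopoint : Subset m → Set
  IsCopoint X = IsFlat X × suc (rank X) ≡ matroidRank

  IsCircuit : Subset m → Set
  IsCircuit Y = Y ⊆ E × ¬ Independent Y × (∀ Z → Z ⊂ Y → Independent Z)

  independent? : Decidable Independent
  independent? A = (A ⊆? E) ×-dec (rank A ℕ.≟ ∣ A ∣)

  isCopoint? : Decidable IsCopoint
  isCopoint? X =
    ((X ⊆? E) ×-dec
     Fin.all? (λ x → (x ∈? E) →-dec ((rank (X ∪ ⁅ x ⁆) ℕ.≟ rank X) →-dec (x ∈? X))))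
    ×-dec (suc (rank X) ℕ.≟ matroidRank)

  isCircuit? : Decidable IsCircuit
  isCircuit? Y =
    (Y ⊆? E) ×-dec (¬? (independent? Y) ×-dec
      map′ (λ ¬∃ Z Z⊂Y → decidable-stable (independent? Z)
                           (λ ¬ind → ¬∃ (Z , Z⊂Y , ¬ind)))
           (λ minimal (Z , Z⊂Y , ¬ind) → ¬ind (minimal Z Z⊂Y))
           (¬? (anySubset? (λ Z → (Z ⊂? Y) ×-dec ¬? (independent? Z)))))

open Matroid

∪-least : ∀ {A B C : Subset m} → A ⊆ C → B ⊆ C → A ∪ B ⊆ C
∪-least {A = A} {B} A⊆C B⊆C = [ A⊆C , B⊆C ]′ ∘ x∈p∪q⁻ A B

∪-monoˡ : ∀ {A B} (C : Subset m) → A ⊆ B → A ∪ C ⊆ B ∪ C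
∪-monoˡ {B = B} C A⊆B = ∪-least (p⊆p∪q C ∘ A⊆B) (q⊆p∪q B C)

restrict : (M : Matroid m) (X : Subset m) → X ⊆ E M → Matroid m
restrict M X X⊆E = record
  { E          = X
  ; rank       = rank M
  ; rank≤size  = λ A⊆X → rank≤size M (X⊆E ∘ A⊆X)
  ; monotone   = λ A⊆B B⊆X → monotone M A⊆B (X⊆E ∘ B⊆X)
  ; submodular = λ A⊆X B⊆X → submodular M (X⊆E ∘ A⊆X) (X⊆E ∘ B⊆X)
  }

contract : (M : Matroid m) (Y : Subset m) → Y ⊆ E M → Matroid m
contract {m} M Y Y⊆E = record
  { E          = E M ─ Y
  ; rank       = rank/Y
  ; rank≤size  = λ {A} A⊆ → begin
      rank/Y A                    ≤⟨ ℕ.∸-monoˡ-≤ (rank M Y) (subadditive (⊆E A⊆)) ⟩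
      ∣ A ∣ + rank M Y ∸ rank M Y ≡⟨ ℕ.m+n∸n≡m ∣ A ∣ (rank M Y) ⟩
      ∣ A ∣                       ∎
  ; monotone   = λ A⊆B B⊆ →
      ℕ.∸-monoˡ-≤ (rank M Y) (monotone M (∪-monoˡ Y A⊆B) (∪Y⊆E B⊆))
  ; submodular = λ {A} {B} A⊆ B⊆ → ℕ.+-cancelʳ-≤ (rank M Y + rank M Y) _ _ (begin
      rank/Y (A ∪ B) + rank/Y (A ∩ B) + (rank M Y + rank M Y)
        ≡⟨ regroup (A ∪ B) (A ∩ B)
             (∪Y⊆E (∪-least A⊆ B⊆)) (∪Y⊆E (A⊆ ∘ p∩q⊆p A B)) ⟩
      rank M ((A ∪ B) ∪ Y) + rank M ((A ∩ B) ∪ Y)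
        ≡⟨ cong₂ (λ C D → rank M C + rank M D)
             (∪-distribʳ A B) (∪-distribʳ-∩ Y A B) ⟩
      rank M ((A ∪ Y) ∪ (B ∪ Y)) + rank M ((A ∪ Y) ∩ (B ∪ Y))
        ≤⟨ submodular M (∪Y⊆E A⊆) (∪Y⊆E B⊆) ⟩
      rank M (A ∪ Y) + rank M (B ∪ Y)
        ≡⟨ sym (regroup A B (∪Y⊆E A⊆) (∪Y⊆E B⊆)) ⟩
      rank/Y A + rank/Y B + (rank M Y + rank M Y) ∎)
  }
  where
  open ℕ.≤-Reasoning

  rank/Y : Subset m → ℕ
  rank/Y A = rank M (A ∪ Y) ∸ rank M Y

  ⊆E : ∀ {A} → A ⊆ E M ─ Y → A ⊆ E M
  ⊆E A⊆ = p─q⊆p (E M) Y ∘ A⊆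

  ∪Y⊆E : ∀ {A} → A ⊆ E M ─ Y → A ∪ Y ⊆ E M
  ∪Y⊆E A⊆ = ∪-least (⊆E A⊆) Y⊆E

  subadditive : ∀ {A} → A ⊆ E M → rank M (A ∪ Y) ≤ ∣ A ∣ + rank M Y
  subadditive {A} A⊆E = begin
    rank M (A ∪ Y)                  ≤⟨ ℕ.m≤m+n _ _ ⟩
    rank M (A ∪ Y) + rank M (A ∩ Y) ≤⟨ submodular M A⊆E Y⊆E ⟩
    rank M A + rank M Y             ≤⟨ ℕ.+-monoˡ-≤ _ (rank≤size M A⊆E) ⟩
    ∣ A ∣ + rank M Y                ∎

  ∪-distribʳ : ∀ A B → (A ∪ B) ∪ Y ≡ (A ∪ Y) ∪ (B ∪ Y)
  ∪-distribʳ A B = ⊆-antisym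
    (∪-least (∪-least (p⊆p∪q _ ∘ p⊆p∪q Y) (q⊆p∪q (A ∪ Y) _ ∘ p⊆p∪q Y))
             (p⊆p∪q _ ∘ q⊆p∪q A Y))
    (∪-least (∪-monoˡ Y (p⊆p∪q B)) (∪-monoˡ Y (q⊆p∪q A B)))

  regroup : ∀ A B → A ∪ Y ⊆ E M → B ∪ Y ⊆ E M →
            rank/Y A + rank/Y B + (rank M Y + rank M Y) ≡
            rank M (A ∪ Y) + rank M (B ∪ Y)
  regroup A B A∪Y⊆E B∪Y⊆E = trans
    (interchange (rank/Y A) (rank/Y B) (rank M Y) (rank M Y))
    (cong₂ _+_ (ℕ.m∸n+n≡m (monotone M (q⊆p∪q A Y) A∪Y⊆E))
               (ℕ.m∸n+n≡m (monotone M (q⊆p∪q B Y) B∪Y⊆E)))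

elements : Subset m → List (Fin m)
elements S = filter (_∈? S) (allFin _)

allSubsets : ∀ m → List (Subset m)
allSubsets zero    = [] ∷ []
allSubsets (suc m) =
  map (outside ∷_) (allSubsets m) ++ map (inside ∷_) (allSubsets m)

-- arrangements k S lists the sequences of k distinct elements of S, each
-- exactly once.

arrangements : ℕ → Subset m → List (List (Fin m))
arrangements zero    S = [] ∷ []
arrangements (suc k) S =
  concatMap (λ x → map (x ∷_) (arrangements k (S - x))) (elements S)

orderings : Subset m → List (List (Fin m))
orderings S = arrangements ∣ S ∣ S

increments : (Subset m → ℕ) → Subset m → List (Fin m) → List ℕ
increments ρ P []      = []
increments ρ P (x ∷ π) = (ρ (P ∪ ⁅ x ⁆) ∸ ρ P) ∷ increments ρ (P ∪ ⁅ x ⁆) π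

-- The first entry is rank {π(1)} ∸ rank ∅, and rank ∅ = 0.

rankSequence : Matroid m → List (Fin m) → List ℕ
rankSequence M π = increments (rank M) ⊥ π

record Symbol (n r : ℕ) : Set where
  constructor symbol
  field
    bits : Vec (Fin 2) n
    ones : count (Fin._≟ 1F) bits ≡ r

  digits : List ℕ
  digits = Vec.toList (Vec.map toℕ bits)

open Symbol public using (digits)

-- For an ordering π of E, the rank sequence is a 0,1-sequence of length
-- |E| with exactly rank E ones.

size-remove : (S : Subset m) {x : Fin m} → x ∈ S → ∣ S ∣ ≡ suc ∣ S - x ∣
size-remove (_ ∷ S)       here        = cong (suc ∘ ∣_∣) (sym (p─⊥≡p S))
size-remove (inside ∷ S)  (there x∈S) = cong suc (size-remove S x∈S)
size-remove (outside ∷ S) (there x∈S) = size-remove S x∈S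

move-element : (P S : Subset m) {x : Fin m} → x ∈ S →
               (P ∪ ⁅ x ⁆) ∪ (S - x) ≡ P ∪ S
move-element P S {x} x∈S = ⊆-antisym
  (∪-least (∪-least (p⊆p∪q S)
                    (λ y∈ → q⊆p∪q P S (subst (_∈ S) (sym (x∈⁅y⁆⇒x≡y x y∈)) x∈S)))
           (q⊆p∪q P S ∘ p─q⊆p S ⁅ x ⁆))
  (∪-least (p⊆p∪q (S - x) ∘ p⊆p∪q ⁅ x ⁆) S⊆)
  where
  S⊆ : S ⊆ (P ∪ ⁅ x ⁆) ∪ (S - x)
  S⊆ {y} y∈S with y Fin.≟ x
  ... | yes refl = p⊆p∪q (S - x) (q⊆p∪q P ⁅ x ⁆ (x∈⁅x⁆ x))
  ... | no y≢x   = q⊆p∪q (P ∪ ⁅ x ⁆) (S - x) (x∈p∧x≢y⇒x∈p-y y∈S y≢x)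

unit-increase : (M : Matroid m) (P : Subset m) (x : Fin m) → P ∪ ⁅ x ⁆ ⊆ E M →
                rank M (P ∪ ⁅ x ⁆) ≤ suc (rank M P)
unit-increase M P x Px⊆E = begin
  rank M (P ∪ ⁅ x ⁆)                      ≤⟨ ℕ.m≤m+n _ _ ⟩
  rank M (P ∪ ⁅ x ⁆) + rank M (P ∩ ⁅ x ⁆) ≤⟨ submodular M P⊆E x⊆E ⟩
  rank M P + rank M ⁅ x ⁆                 ≤⟨ ℕ.+-monoʳ-≤ _ (rank≤size M x⊆E) ⟩
  rank M P + ∣ ⁅ x ⁆ ∣                    ≡⟨ cong (rank M P +_) (∣⁅x⁆∣≡1 x) ⟩
  rank M P + 1                            ≡⟨ ℕ.+-comm (rank M P) 1 ⟩
  suc (rank M P)                          ∎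
  where
  open ℕ.≤-Reasoning
  P⊆E : P ⊆ E M
  P⊆E = Px⊆E ∘ p⊆p∪q ⁅ x ⁆
  x⊆E : ⁅ x ⁆ ⊆ E M
  x⊆E = Px⊆E ∘ q⊆p∪q P ⁅ x ⁆

cons-digit : ∀ {d j k t} → d ≤ 1 →
             (∃ λ (s : Symbol n j) → digits s ≡ t) → d + j ≡ k →
             ∃ λ (s : Symbol (suc n) k) → digits s ≡ d ∷ t
cons-digit {d = 0} _ (symbol b o , eq) e =
  symbol (0F ∷ b) (trans o e) , cong (0 ∷_) eq
cons-digit {d = 1} _ (symbol b o , eq) e =
  symbol (1F ∷ b) (trans (cong suc o) e) , cong (1 ∷_) eq
cons-digit {d = suc (suc _)} (s≤s ()) _ _

increments-isSymbol :
  (M : Matroid m) (P S : Subset m) → P ∪ S ⊆ E M → ∀ k → ∣ S ∣ ≡ k →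
  ∀ {π} → π List∈.∈ arrangements k S →
  ∃ λ (s : Symbol k (rank M (P ∪ S) ∸ rank M P)) →
    digits s ≡ increments (rank M) P π
increments-isSymbol M P S PS⊆E zero ∣S∣≡0 (here refl) =
  symbol [] (sym (trans (cong (λ A → rank M A ∸ rank M P) P∪S≡P)
                        (ℕ.n∸n≡0 (rank M P)))) , refl
  where
  P∪S≡P : P ∪ S ≡ P
  P∪S≡P = ⊆-antisym
    (∪-least id (λ x∈S → contradiction (trans (sym (size-remove S x∈S)) ∣S∣≡0) λ ()))
    (p⊆p∪q S)
increments-isSymbol M P S PS⊆E (suc k) ∣S∣≡1+k π∈
  with x , x∈elements , π∈′ ← List∈.find
         (∈-concatMap⁻ (λ x → map (x ∷_) (arrangements k (S - x)))
                         {xs = elements S} π∈)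
  with π′ , π′∈ , refl ← ∈-map⁻ (x ∷_) π∈′ =
  cons-digit
    (ℕ.≤-trans (ℕ.∸-monoˡ-≤ (rank M P) (unit-increase M P x Px⊆E))
               (ℕ.≤-reflexive (ℕ.m+n∸n≡m 1 (rank M P))))
    (increments-isSymbol M (P ∪ ⁅ x ⁆) (S - x) PxS⊆E k
      (ℕ.suc-injective (trans (sym (size-remove S x∈S)) ∣S∣≡1+k)) π′∈)
    telescope
  where
  x∈S : x ∈ S
  x∈S = proj₂ (∈-filter⁻ (_∈? S) {xs = allFin _} x∈elements)
  PxS≡PS : (P ∪ ⁅ x ⁆) ∪ (S - x) ≡ P ∪ S
  PxS≡PS = move-element P S x∈S
  PxS⊆E : (P ∪ ⁅ x ⁆) ∪ (S - x) ⊆ E M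
  PxS⊆E = PS⊆E ∘ subst (_ ∈_) PxS≡PS
  Px⊆E : P ∪ ⁅ x ⁆ ⊆ E M
  Px⊆E = PxS⊆E ∘ p⊆p∪q (S - x)
  telescope : (rank M (P ∪ ⁅ x ⁆) ∸ rank M P)
              + (rank M ((P ∪ ⁅ x ⁆) ∪ (S - x)) ∸ rank M (P ∪ ⁅ x ⁆))
              ≡ rank M (P ∪ S) ∸ rank M P
  telescope = begin
    (b ∸ a) + (rank M ((P ∪ ⁅ x ⁆) ∪ (S - x)) ∸ b)
      ≡⟨ cong (λ A → (b ∸ a) + (rank M A ∸ b)) PxS≡PS ⟩
    (b ∸ a) + (c ∸ b)  ≡⟨ ℕ.+-comm (b ∸ a) (c ∸ b) ⟩
    (c ∸ b) + (b ∸ a)  ≡⟨ sym (ℕ.+-∸-assoc (c ∸ b) a≤b) ⟩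
    (c ∸ b) + b ∸ a    ≡⟨ cong (_∸ a) (ℕ.m∸n+n≡m b≤c) ⟩
    c ∸ a              ∎
    where
    open ≡-Reasoning
    a b c : ℕ
    a = rank M P
    b = rank M (P ∪ ⁅ x ⁆)
    c = rank M (P ∪ S)
    a≤b : a ≤ b
    a≤b = monotone M (p⊆p∪q ⁅ x ⁆) Px⊆E
    b≤c : b ≤ c
    b≤c = monotone M (subst (_ ∈_) PxS≡PS ∘ p⊆p∪q (S - x)) PS⊆E

rankSequence-isSymbol :
  (M : Matroid m) → ∀ {π} → π List∈.∈ orderings (E M) →
  ∃ λ (s : Symbol (size M) (matroidRank M)) → digits s ≡ rankSequence M π
rankSequence-isSymbol {m} M {π} π∈ =
  subst (λ k → ∃ λ (s : Symbol (size M) k) → digits s ≡ rankSequence M π)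
        rank-eq
        (increments-isSymbol M ⊥ (E M) ⊥∪E⊆E ∣ E M ∣ refl π∈)
  where
  ⊥∪E⊆E : ⊥ ∪ E M ⊆ E M
  ⊥∪E⊆E = ∪-least ⊥⊆ id
  rank⊥≡0 : rank M ⊥ ≡ 0
  rank⊥≡0 = ℕ.n≤0⇒n≡0 (subst (rank M ⊥ ≤_) (∣⊥∣≡0 m) (rank≤size M ⊥⊆))
  rank-eq : rank M (⊥ ∪ E M) ∸ rank M ⊥ ≡ rank M (E M)
  rank-eq = cong₂ (λ A k → rank M A ∸ k)
                  (⊆-antisym ⊥∪E⊆E (q⊆p∪q ⊥ (E M))) rank⊥≡0

CharacteristicZero : ∀ {c ℓ₁ ℓ₂} → HeytingField c ℓ₁ ℓ₂ → Set ℓ₁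
CharacteristicZero K = ∀ n → ¬ (suc n ×K 1# ≈ 0#)
  where
  open HeytingField K using (_≈_; 0#; 1#; heytingCommutativeRing)
  open HeytingCommutativeRing heytingCommutativeRing using (commutativeRing)
  open RawMonoidDefinitions (CommutativeRing.+-rawMonoid commutativeRing)
    renaming (_×_ to _×K_)

module Invariant {c ℓ₁ ℓ₂} (K : HeytingField c ℓ₁ ℓ₂) where

  private
    module K = HeytingField K

  -- The basis of symbols is finite, so vectors are coefficient functions.

  𝒢 : ℕ → ℕ → Set c
  𝒢 n r = Symbol n r → K.Carrier

  0𝒢 : 𝒢 n r
  0𝒢 _ = K.0#

  infixl 6 _+𝒢_

  _+𝒢_ : 𝒢 n r → 𝒢 n r → 𝒢 n r
  (f +𝒢 g) s = f s K.+ g s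

  -- The basis vector of the symbol spelled by t.  (A list t spelling no
  -- symbol would give 0𝒢; rankSequence-isSymbol shows that this does
  -- not happen for rank sequences.)

  [_] : List ℕ → 𝒢 n r
  [ t ] s = if does (≡-dec ℕ._≟_ t (digits s)) then K.1# else K.0#

  𝒢-invariant : (M : Matroid m) → 𝒢 (size M) (matroidRank M)
  𝒢-invariant M = foldr _+𝒢_ 0𝒢 (map ([_] ∘ rankSequence M) (orderings (E M)))

  -- 𝒢-invariants of different matroids are compared in the disjoint union
  -- of the spaces 𝒢(n,r); equal elements lie in the same space.

  ⋃𝒢 : Set c
  ⋃𝒢 = ∃ λ n → ∃ λ r → 𝒢 n r

  infix 4 _≈𝒢_

  data _≈𝒢_ : ⋃𝒢 → ⋃𝒢 → Set (c ⊔ ℓ₁) where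
    pointwise : {f g : 𝒢 n r} → (∀ s → f s K.≈ g s) →
                (n , r , f) ≈𝒢 (n , r , g)

  ⋃𝒢-setoid : Setoid c (c ⊔ ℓ₁)
  ⋃𝒢-setoid = record
    { Carrier       = ⋃𝒢
    ; _≈_           = _≈𝒢_
    ; isEquivalence = record
      { refl  = pointwise (λ _ → K.refl)
      ; sym   = λ { (pointwise p) → pointwise (λ s → K.sym (p s)) }
      ; trans = λ { (pointwise p) (pointwise q) →
                    pointwise (λ s → K.trans (p s) (q s)) }
      }
    }

  𝒢[_] : Matroid m → ⋃𝒢
  𝒢[ M ] = size M , matroidRank M , 𝒢-invariant M

  -- A multiset is a list up to permutation; the entries of a deck are
  -- identified only through _≈𝒢_.

  open import Data.List.Relation.Binary.Permutation.Setoid ⋃𝒢-setoid public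
    using (_↭_)

  copointDeck : Matroid m → List ⋃𝒢
  copointDeck {m} M =
    reduce (λ {X} ((X⊆E , _) , _) → 𝒢[ restrict M X X⊆E ])
           (all-filter (isCopoint? M) (allSubsets m))

  circuitDeck : Matroid m → List ⋃𝒢
  circuitDeck {m} M =
    reduce (λ {Y} (Y⊆E , _) → 𝒢[ contract M Y Y⊆E ])
           (all-filter (isCircuit? M) (allSubsets m))

{-# OPTIONS --safe #-}

-- Let F t be the number of ∣t∣-arrangements of E with rank sequence t; the
-- coefficients of 𝒢(M) are the values of F at words of length n.  If t has
-- r − 1 ones, such an arrangement spans a unique copoint H, so F t is the sum
-- over H of the same count for M|H, which is the coefficient of t0…0 in
-- 𝒢(M|H) divided by (∣H∣ − ∣t∣)!.  Hence the deck determines F at words with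
-- r − 1 ones.
--
-- The size n is found by cutting every ordering of E at the moment its prefix
-- reaches rank r − 1: n! = Σ_t F t · (n − ∣t∣)!, over the words t with r − 1
-- ones that end in 1.  Since r ≥ 2 these t are nonempty, so
-- Σ_t F t · (n − ∣t∣)! / n! is strictly decreasing in n and equals 1 only once.
--
-- Knowing n, the identity F(t0) + F(t1) = (n − ∣t∣) F(t) extends F to the words
-- with r ones.  The second half is the first one for the dual matroid: the
-- circuits of M are the complements of the copoints of M*, and (M/Y)* = M*|(E−Y).

module Submission where

open import Algebra.Apartness.Bundles
  using (HeytingField; module HeytingCommutativeRing)
open import Algebra.Bundles using (CommutativeRing)
import Algebra.Properties.CommutativeSemigroup as CommutativeSemigroup
import Algebra.Properties.Group as GroupProperties
import Algebra.Properties.Monoid.Mult as Mult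
open import Data.Bool.Base using (true; false; if_then_else_)
import Data.Bool.Properties as Bool
open import Data.Empty using (⊥-elim)
open import Data.Fin.Base using (Fin; suc; toℕ; opposite)
open import Data.Fin.Patterns using (0F; 1F)
import Data.Fin.Properties as Fin
open import Data.Fin.Subset
open import Data.Fin.Subset.Properties
open import Data.List.Base
  using (List; []; _∷_; _++_; _∷ʳ_; map; concatMap; filter; foldr; length;
         replicate; tabulate; upTo; allFin)
open import Data.List.Membership.Propositional using () renaming (_∈_ to _∈ˡ_)
open import Data.List.Membership.Propositional.Properties
  using (∈-filter⁻; ∈-filter⁺; ∈-map⁺; ∈-map⁻; ∈-++⁺ˡ; ∈-++⁺ʳ; ∈-upTo⁺)
open import Data.List.Properties
  using (≡-dec; map-tabulate; map-∘; map-++; ∷-injectiveˡ; ∷-injectiveʳ;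
         length-++; length-replicate; ++-assoc; ++-identityʳ)
import Data.List.Relation.Binary.Permutation.Setoid.Properties as Permutation
open import Data.List.Relation.Unary.All as All using (reduce; [])
open import Data.List.Relation.Unary.All.Properties using (all-filter)
open import Data.List.Relation.Unary.Any using (here; there)
open import Data.List.Relation.Unary.Unique.Propositional using (Unique; []; _∷_)
import Data.List.Relation.Unary.Unique.Propositional.Properties as Unique
open import Data.List.Reverse using (Reverse; reverseView; _∶_∶ʳ_; [])
open import Data.Nat.Base
  using (ℕ; zero; suc; _+_; _*_; _∸_; _≤_; _<_; z≤n; s≤s; s<s⁻¹; _!)
open import Data.Nat.ListAction using (sum)
open import Data.Nat.ListAction.Properties using (sum-++)
import Data.Nat.Properties as ℕ
open import Data.Nat.Solver using (module +-*-Solver)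
open import Data.Product.Base using (_×_; _,_; proj₁; proj₂)
open import Data.Sum.Base using (inj₁; inj₂; [_,_]′)
import Data.Vec.Base as Vec
open import Data.Vec.Base using ([]; _∷_; here; there)
import Data.Vec.Properties as Vec
open import Function.Base using (_∘_; id)
open import Relation.Binary.Definitions using (DecidableEquality; tri<; tri≈; tri>)
open import Relation.Binary.PropositionalEquality
  using (_≡_; _≢_; refl; sym; trans; cong; cong₂; subst; subst₂; module ≡-Reasoning)
open import Relation.Nullary.Decidable
  using (Dec; yes; no; does; _because_; _×-dec_; dec-true; dec-false; decidable-stable)
open import Relation.Nullary.Negation using (¬_; contradiction)
open import Relation.Nullary.Reflects using (invert)
open import Relation.Unary using (Pred; Decidable)
open import Defs

open CommutativeSemigroup ℕ.+-commutativeSemigroup using (interchange)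
open CommutativeSemigroup ℕ.*-commutativeSemigroup using ()
  renaming (x∙yz≈y∙xz to *-exchange)

-- Reconstruction takes the form of injectivity: `M` and `N`, on unrelated ground sets, have equal
-- invariants once their decks are equal as multisets. An unlabeled deck is accessible only through
-- symmetric functions of its entries; the one chosen is the sum over all entries of the coefficient
-- at a fixed word. In characteristic zero `ℕ` embeds in the field, so these sums are natural
-- numbers and the argument proper is counting in `ℕ`. The divisions of the overview accordingly
-- become the cancelling of a factorial or a cross-multiplied inequality. Summing over the deck
-- hides the sizes of the copoints, on which those factorials depend, and nothing is assumed about
-- the rank of `N`; both have to be regained from the sums alone.

private
  variable
    m n r : ℕ

-- Finite sums of natural numbers

⟦_⟧ : ∀ {p} {P : Set p} → Dec P → ℕ
⟦ P? ⟧ = if does P? then 1 else 0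

module _ {p} {P : Set p} where

  ⟦⟧-yes : (P? : Dec P) → P → ⟦ P? ⟧ ≡ 1
  ⟦⟧-yes P? x rewrite dec-true P? x = refl

  ⟦⟧-no : (P? : Dec P) → ¬ P → ⟦ P? ⟧ ≡ 0
  ⟦⟧-no P? ¬x rewrite dec-false P? ¬x = refl

  -- The factor in front serves as a hypothesis: where it fails, both products are 0.
  ⟦⟧*-congʳ : (P? : Dec P) {a b : ℕ} → (P → a ≡ b) → ⟦ P? ⟧ * a ≡ ⟦ P? ⟧ * b
  ⟦⟧*-congʳ (yes x) a≡b = cong (1 *_) (a≡b x)
  ⟦⟧*-congʳ (no _)  _   = refl

  ⟦⟧-cong : ∀ {q} {Q : Set q} (P? : Dec P) (Q? : Dec Q) →
            (P → Q) → (Q → P) → ⟦ P? ⟧ ≡ ⟦ Q? ⟧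
  ⟦⟧-cong P? (yes y) _ g = ⟦⟧-yes P? (g y)
  ⟦⟧-cong P? (no ¬y) f _ = ⟦⟧-no P? (¬y ∘ f)

  ⟦⟧-× : ∀ {q} {Q : Set q} (P? : Dec P) (Q? : Dec Q) →
         ⟦ P? ×-dec Q? ⟧ ≡ ⟦ P? ⟧ * ⟦ Q? ⟧
  ⟦⟧-× (yes _) (yes _) = refl
  ⟦⟧-× (yes _) (no _)  = refl
  ⟦⟧-× (no _)  _       = refl

⟦≟0⟧+⟦≟1⟧ : ∀ {n} → n ≤ 1 → ⟦ n ℕ.≟ 0 ⟧ + ⟦ n ℕ.≟ 1 ⟧ ≡ 1
⟦≟0⟧+⟦≟1⟧ {0} _ = refl
⟦≟0⟧+⟦≟1⟧ {1} _ = refl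
⟦≟0⟧+⟦≟1⟧ {suc (suc _)} (s≤s ())

∑ : ∀ {a} {A : Set a} → List A → (A → ℕ) → ℕ
∑ xs f = sum (map f xs)

infixr 6 ∑
syntax ∑ xs (λ x → e) = ∑[ x ← xs ] e

module _ {a} {A : Set a} where

  ∑-cong : ∀ (xs : List A) {f g : A → ℕ} → (∀ {x} → x ∈ˡ xs → f x ≡ g x) →
           ∑ xs f ≡ ∑ xs g
  ∑-cong []       _   = refl
  ∑-cong (x ∷ xs) f≡g = cong₂ _+_ (f≡g (here refl)) (∑-cong xs (f≡g ∘ there))

  ∑-const : ∀ (xs : List A) k → (∑[ _ ← xs ] k) ≡ length xs * k
  ∑-const []       k = refl
  ∑-const (x ∷ xs) k = cong (k +_) (∑-const xs k)

  ∑-zero : ∀ (xs : List A) {f : A → ℕ} → (∀ {x} → x ∈ˡ xs → f x ≡ 0) → ∑ xs f ≡ 0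
  ∑-zero xs f≡0 = trans (∑-cong xs f≡0) (trans (∑-const xs 0) (ℕ.*-zeroʳ (length xs)))

  ∑-+ : ∀ (xs : List A) (f g : A → ℕ) → (∑[ x ← xs ] (f x + g x)) ≡ ∑ xs f + ∑ xs g
  ∑-+ []       f g = refl
  ∑-+ (x ∷ xs) f g = trans (cong (f x + g x +_) (∑-+ xs f g))
                           (interchange (f x) (g x) (∑ xs f) (∑ xs g))

  ∑-*ˡ : ∀ (xs : List A) k (f : A → ℕ) → (∑[ x ← xs ] (k * f x)) ≡ k * ∑ xs f
  ∑-*ˡ []       k f = sym (ℕ.*-zeroʳ k)
  ∑-*ˡ (x ∷ xs) k f = trans (cong (k * f x +_) (∑-*ˡ xs k f))
                            (sym (ℕ.*-distribˡ-+ k (f x) (∑ xs f)))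

  ∑-filter : ∀ {p} {P : Pred A p} (P? : Decidable P) xs (f : A → ℕ) →
             ∑ (filter P? xs) f ≡ ∑[ x ← xs ] ⟦ P? x ⟧ * f x
  ∑-filter P? []       f = refl
  ∑-filter P? (x ∷ xs) f with does (P? x)
  ... | true  = cong₂ _+_ (sym (ℕ.*-identityˡ (f x))) (∑-filter P? xs f)
  ... | false = ∑-filter P? xs f

module _ {a} {A : Set a} where

  ∑-swap : ∀ {b} {B : Set b} (xs : List A) (ys : List B) (f : A → B → ℕ) →
           (∑[ x ← xs ] ∑[ y ← ys ] f x y) ≡ ∑[ y ← ys ] ∑[ x ← xs ] f x y
  ∑-swap []       ys f = sym (∑-zero ys (λ _ → refl))
  ∑-swap (x ∷ xs) ys f = trans (cong (∑ ys (f x) +_) (∑-swap xs ys f))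
                               (sym (∑-+ ys (f x) (λ y → ∑ xs (λ x → f x y))))

  ∑-concatMap : ∀ {b} {B : Set b} (g : A → List B) xs (f : B → ℕ) →
                ∑ (concatMap g xs) f ≡ ∑[ x ← xs ] ∑ (g x) f
  ∑-concatMap g []       f = refl
  ∑-concatMap g (x ∷ xs) f = begin
    ∑ (g x ++ concatMap g xs) f             ≡⟨ cong sum (map-++ f (g x) _) ⟩
    sum (map f (g x) ++ map f (concatMap g xs)) ≡⟨ sum-++ (map f (g x)) _ ⟩
    ∑ (g x) f + ∑ (concatMap g xs) f        ≡⟨ cong (∑ (g x) f +_) (∑-concatMap g xs f) ⟩
    ∑ (g x) f + (∑[ x ← xs ] ∑ (g x) f)     ∎
    where
    open ≡-Reasoning

  ∑-single : ∀ {xs : List A} {x} (f : A → ℕ) → Unique xs → x ∈ˡ xs →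
             (∀ {y} → y ∈ˡ xs → y ≢ x → f y ≡ 0) → ∑ xs f ≡ f x
  ∑-single {x ∷ xs} f (x∉xs ∷ _) (here refl) f≡0 =
    trans (cong (f x +_) (∑-zero xs (λ y∈ → f≡0 (there y∈) (All.lookup x∉xs y∈ ∘ sym))))
          (ℕ.+-identityʳ (f x))
  ∑-single {y ∷ xs} f (y∉xs ∷ u) (there x∈) f≡0 =
    cong₂ _+_ (f≡0 (here refl) (All.lookup y∉xs x∈)) (∑-single f u x∈ (f≡0 ∘ there))

-- Double counting along the graph of `g`: the double sum of `⟦ y ≟ g x ⟧ * f y` collapses to the
-- left side when `y` is summed first and to the right side when `x` is.
∑-reindex : ∀ {a b} {A : Set a} {B : Set b} → DecidableEquality B →
            ∀ {xs : List A} {ys : List B} {g : A → B} {h : B → A} →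
            Unique xs → Unique ys →
            (∀ {x} → x ∈ˡ xs → g x ∈ˡ ys) → (∀ {y} → y ∈ˡ ys → h y ∈ˡ xs) →
            (∀ {x} → x ∈ˡ xs → h (g x) ≡ x) → (∀ {y} → y ∈ˡ ys → g (h y) ≡ y) →
            ∀ (f : B → ℕ) → ∑ xs (f ∘ g) ≡ ∑ ys f
∑-reindex _≟_ {xs} {ys} {g} {h} u v g∈ h∈ hg gh f = begin
  ∑ xs (f ∘ g)
    ≡⟨ ∑-cong xs (λ {x} x∈ → sym (trans
         (∑-single (λ y → ⟦ y ≟ g x ⟧ * f y) v (g∈ x∈)
           (λ {y} _ y≢ → cong (_* f y) (⟦⟧-no (y ≟ g x) y≢)))
         (trans (cong (_* f (g x)) (⟦⟧-yes (g x ≟ g x) refl)) (ℕ.*-identityˡ _)))) ⟩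
  (∑[ x ← xs ] ∑[ y ← ys ] ⟦ y ≟ g x ⟧ * f y)
    ≡⟨ ∑-swap xs ys _ ⟩
  (∑[ y ← ys ] ∑[ x ← xs ] ⟦ y ≟ g x ⟧ * f y)
    ≡⟨ ∑-cong ys (λ {y} y∈ → trans
         (∑-single (λ x → ⟦ y ≟ g x ⟧ * f y) u (h∈ y∈)
           (λ {x} x∈ x≢ → cong (_* f y) (⟦⟧-no (y ≟ g x)
             (λ y≡ → x≢ (trans (sym (hg x∈)) (cong h (sym y≡)))))))
         (trans (cong (_* f y) (⟦⟧-yes (y ≟ g (h y)) (sym (gh y∈)))) (ℕ.*-identityˡ _))) ⟩
  ∑ ys f ∎
  where open ≡-Reasoning

-- Counting arrangements by their rank increments

x∈p─q⇒x∉q : ∀ {x} (p q : Subset m) → x ∈ p ─ q → x ∉ q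
x∈p─q⇒x∉q (_ ∷ p) (_ ∷ q) (there x∈) (there x∈q) = x∈p─q⇒x∉q p q x∈ x∈q

∪⁅⁆-⊆ : ∀ {P Q : Subset m} {x} → P ⊆ Q → x ∈ Q → P ∪ ⁅ x ⁆ ⊆ Q
∪⁅⁆-⊆ {Q = Q} {x} P⊆Q x∈Q = ∪-least P⊆Q (λ y∈ → subst (_∈ Q) (sym (x∈⁅y⁆⇒x≡y x y∈)) x∈Q)

∪⁅⁆-⊆⁻ : ∀ {P Q : Subset m} {x} → P ∪ ⁅ x ⁆ ⊆ Q → x ∈ Q
∪⁅⁆-⊆⁻ {P = P} {x = x} Px⊆Q = Px⊆Q (q⊆p∪q P ⁅ x ⁆ (x∈⁅x⁆ x))

∣p∣≡0⇒p≡⊥ : {p : Subset m} → ∣ p ∣ ≡ 0 → p ≡ ⊥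
∣p∣≡0⇒p≡⊥ ∣p∣≡0 =
  Empty-unique λ { (x , x∈p) → contradiction (trans (sym (size-remove _ x∈p)) ∣p∣≡0) λ () }

∪-empty : (p : Subset m) {q : Subset m} → ∣ q ∣ ≡ 0 → p ∪ q ≡ p
∪-empty p ∣q∣≡0 = trans (cong (p ∪_) (∣p∣≡0⇒p≡⊥ ∣q∣≡0)) (∪-identityʳ p)

∈-elements⁻ : (S : Subset m) → ∀ {x} → x ∈ˡ elements S → x ∈ S
∈-elements⁻ S x∈ = proj₂ (∈-filter⁻ (_∈? S) {xs = allFin _} x∈)

∑-elements : ∀ (S : Subset m) f → ∑ (elements S) f ≡ ∑[ x ← allFin m ] ⟦ x ∈? S ⟧ * f x
∑-elements S f = ∑-filter (_∈? S) (allFin _) f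

∑-elements-1 : ∀ (S : Subset m) → (∑[ _ ← elements S ] 1) ≡ ∣ S ∣
∑-elements-1 {m} S = trans (∑-elements S (λ _ → 1))
  (trans (∑-cong (allFin m) (λ {x} _ → ℕ.*-identityʳ ⟦ x ∈? S ⟧)) (indicators S))
  where
  indicators : ∀ {m} (S : Subset m) → ∑[ x ← allFin m ] ⟦ x ∈? S ⟧ ≡ ∣ S ∣
  tail : ∀ {m} s (S : Subset m) → sum (map (λ x → ⟦ x ∈? s ∷ S ⟧) (tabulate suc)) ≡ ∣ S ∣
  tail s S = trans (cong sum (trans (map-tabulate suc (λ x → ⟦ x ∈? s ∷ S ⟧))
                   (sym (map-tabulate id (λ x → ⟦ suc x ∈? s ∷ S ⟧)))))
      (trans (∑-cong (allFin _) λ {x} _ → ⟦⟧-cong (suc x ∈? s ∷ S) (x ∈? S) drop-there there)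
             (indicators S))
  indicators []       = refl
  indicators (inside  ∷ S) = cong suc (tail inside S)
  indicators (outside ∷ S) = tail outside S

-- Both double sums range over the ordered pairs of distinct elements of `S`, a symmetric condition.
∑-elements-swap : ∀ (S : Subset m) (f : Fin m → Fin m → ℕ) →
  (∑[ x ← elements S ] ∑[ y ← elements (S - x) ] f x y) ≡
  ∑[ y ← elements S ] ∑[ x ← elements (S - y) ] f x y
∑-elements-swap {m} S f = begin
  (∑[ x ← elements S ] ∑[ y ← elements (S - x) ] f x y)
    ≡⟨ expand f ⟩
  (∑[ x ← allFin m ] ∑[ y ← allFin m ] ⟦ x ∈? S ⟧ * (⟦ y ∈? S - x ⟧ * f x y))
    ≡⟨ ∑-swap (allFin m) (allFin m) _ ⟩
  (∑[ y ← allFin m ] ∑[ x ← allFin m ] ⟦ x ∈? S ⟧ * (⟦ y ∈? S - x ⟧ * f x y))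
    ≡⟨ ∑-cong (allFin m) (λ {y} _ → ∑-cong (allFin m) λ {x} _ → pair x y) ⟩
  (∑[ y ← allFin m ] ∑[ x ← allFin m ] ⟦ y ∈? S ⟧ * (⟦ x ∈? S - y ⟧ * f x y))
    ≡⟨ expand (λ y x → f x y) ⟨
  (∑[ y ← elements S ] ∑[ x ← elements (S - y) ] f x y) ∎
  where
  open ≡-Reasoning
  expand : ∀ f → (∑[ x ← elements S ] ∑[ y ← elements (S - x) ] f x y) ≡
           ∑[ x ← allFin m ] ∑[ y ← allFin m ] ⟦ x ∈? S ⟧ * (⟦ y ∈? S - x ⟧ * f x y)
  expand f = trans (∑-elements S _) (∑-cong (allFin m) λ {x} _ →
    trans (cong (⟦ x ∈? S ⟧ *_) (∑-elements (S - x) (f x)))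
          (sym (∑-*ˡ (allFin m) ⟦ x ∈? S ⟧ _)))
  exchange : ∀ {x y} → x ∈ S × y ∈ S - x → y ∈ S × x ∈ S - y
  exchange {x} {y} (x∈S , y∈S-x) =
    p─q⊆p S ⁅ x ⁆ y∈S-x ,
    x∈p∧x≢y⇒x∈p-y x∈S λ { refl → x∈p─q⇒x∉q S ⁅ x ⁆ y∈S-x (x∈⁅x⁆ x) }
  pair : ∀ x y → ⟦ x ∈? S ⟧ * (⟦ y ∈? S - x ⟧ * f x y) ≡ ⟦ y ∈? S ⟧ * (⟦ x ∈? S - y ⟧ * f x y)
  pair x y = begin
    ⟦ x ∈? S ⟧ * (⟦ y ∈? S - x ⟧ * f x y) ≡⟨ ℕ.*-assoc ⟦ x ∈? S ⟧ _ _ ⟨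
    ⟦ x ∈? S ⟧ * ⟦ y ∈? S - x ⟧ * f x y   ≡⟨ cong (_* f x y) (⟦⟧-× (x ∈? S) (y ∈? S - x)) ⟨
    ⟦ (x ∈? S) ×-dec (y ∈? S - x) ⟧ * f x y
      ≡⟨ cong (_* f x y) (⟦⟧-cong ((x ∈? S) ×-dec (y ∈? S - x)) ((y ∈? S) ×-dec (x ∈? S - y))
           exchange exchange) ⟩
    ⟦ (y ∈? S) ×-dec (x ∈? S - y) ⟧ * f x y ≡⟨ cong (_* f x y) (⟦⟧-× (y ∈? S) (x ∈? S - y)) ⟩
    ⟦ y ∈? S ⟧ * ⟦ x ∈? S - y ⟧ * f x y   ≡⟨ ℕ.*-assoc ⟦ y ∈? S ⟧ _ _ ⟩
    ⟦ y ∈? S ⟧ * (⟦ x ∈? S - y ⟧ * f x y) ∎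

-- Words and the arrangements that spell them

Word : Set
Word = List (Fin 2)

ones : Word → ℕ
ones t = Vec.count (Fin._≟ 1F) (Vec.fromList t)

ones-∷ : ∀ d t → ones (d ∷ t) ≡ toℕ d + ones t
ones-∷ 0F t = refl
ones-∷ 1F t = refl

ones-∷ʳ : ∀ t d → ones (t ∷ʳ d) ≡ ones t + toℕ d
ones-∷ʳ []       d = trans (ones-∷ d []) (ℕ.+-identityʳ (toℕ d))
ones-∷ʳ (e ∷ t) d = begin
  ones (e ∷ t ∷ʳ d)        ≡⟨ ones-∷ e (t ∷ʳ d) ⟩
  toℕ e + ones (t ∷ʳ d)    ≡⟨ cong (toℕ e +_) (ones-∷ʳ t d) ⟩
  toℕ e + (ones t + toℕ d) ≡⟨ ℕ.+-assoc (toℕ e) _ _ ⟨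
  toℕ e + ones t + toℕ d   ≡⟨ cong (_+ toℕ d) (ones-∷ e t) ⟨
  ones (e ∷ t) + toℕ d     ∎
  where open ≡-Reasoning

step : (Subset m → ℕ) → Subset m → Fin m → ℕ
step ρ P x = ρ (P ∪ ⁅ x ⁆) ∸ ρ P

-- The count `F` of the overview is the case `P = ⊥`, `S = E`. In general `P` holds the elements
-- already placed and `S` those still available; `t` may be shorter than `S`, so partial orderings
-- are counted too.
ν : (Subset m → ℕ) → (P S : Subset m) → Word → ℕ
ν ρ P S []      = 1
ν ρ P S (d ∷ t) = ∑[ x ← elements S ] ⟦ step ρ P x ℕ.≟ toℕ d ⟧ * ν ρ (P ∪ ⁅ x ⁆) (S - x) t

∑-arrangements : ∀ (ρ : Subset m → ℕ) P S t →
  (∑[ π ← arrangements (length t) S ] ⟦ ≡-dec ℕ._≟_ (increments ρ P π) (map toℕ t) ⟧) ≡ ν ρ P S t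
∑-arrangements ρ P S []      = refl
∑-arrangements ρ P S (d ∷ t) =
  trans (∑-concatMap _ (elements S) _) (∑-cong (elements S) λ {x} _ → begin
    (∑[ π ← map (x ∷_) (arrangements (length t) (S - x)) ]
      ⟦ ≡-dec ℕ._≟_ (increments ρ P π) (map toℕ (d ∷ t)) ⟧)
      ≡⟨ cong sum (map-∘ (arrangements (length t) (S - x))) ⟨
    (∑[ π ← arrangements (length t) (S - x) ]
      ⟦ ≡-dec ℕ._≟_ (increments ρ P (x ∷ π)) (map toℕ (d ∷ t)) ⟧)
      ≡⟨ ∑-cong (arrangements (length t) (S - x)) (λ {π} _ → trans
           (⟦⟧-cong (≡-dec ℕ._≟_ (increments ρ P (x ∷ π)) (map toℕ (d ∷ t)))
             ((step ρ P x ℕ.≟ toℕ d) ×-dec ≡-dec ℕ._≟_ (increments ρ (P ∪ ⁅ x ⁆) π) (map toℕ t))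
             (λ eq → ∷-injectiveˡ eq , ∷-injectiveʳ eq)
             (λ (p , q) → cong₂ _∷_ p q))
           (⟦⟧-× (step ρ P x ℕ.≟ toℕ d) (≡-dec ℕ._≟_ (increments ρ (P ∪ ⁅ x ⁆) π) (map toℕ t)))) ⟩
    (∑[ π ← arrangements (length t) (S - x) ] ⟦ step ρ P x ℕ.≟ toℕ d ⟧ *
      ⟦ ≡-dec ℕ._≟_ (increments ρ (P ∪ ⁅ x ⁆) π) (map toℕ t) ⟧)
      ≡⟨ ∑-*ˡ (arrangements (length t) (S - x)) ⟦ step ρ P x ℕ.≟ toℕ d ⟧ _ ⟩
    ⟦ step ρ P x ℕ.≟ toℕ d ⟧ * (∑[ π ← arrangements (length t) (S - x) ]
      ⟦ ≡-dec ℕ._≟_ (increments ρ (P ∪ ⁅ x ⁆) π) (map toℕ t) ⟧)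
      ≡⟨ cong (⟦ step ρ P x ℕ.≟ toℕ d ⟧ *_) (∑-arrangements ρ (P ∪ ⁅ x ⁆) (S - x) t) ⟩
    ⟦ step ρ P x ℕ.≟ toℕ d ⟧ * ν ρ (P ∪ ⁅ x ⁆) (S - x) t ∎)
  where open ≡-Reasoning

ν-long : ∀ (ρ : Subset m → ℕ) P S t → ∣ S ∣ < length t → ν ρ P S t ≡ 0
ν-long ρ P S (d ∷ t) ∣S∣< = ∑-zero (elements S) λ {x} x∈ →
  trans (cong (⟦ step ρ P x ℕ.≟ toℕ d ⟧ *_)
          (ν-long ρ (P ∪ ⁅ x ⁆) (S - x) t
            (s<s⁻¹ (subst (_< length (d ∷ t)) (size-remove S (∈-elements⁻ S x∈)) ∣S∣<))))
        (ℕ.*-zeroʳ ⟦ step ρ P x ℕ.≟ toℕ d ⟧)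

-- `ν` peels off the first letter; reversing an ordering requires peeling off the last. As the word
-- exhausts `S`, the set preceding a last element `x` is `P ∪ (S - x)` in whatever order it was
-- filled, so the last increment depends on `x` alone. The induction exchanges the choices of the
-- first and the last element.
ν-∷ʳ : ∀ (ρ : Subset m → ℕ) P S t d → ∣ S ∣ ≡ suc (length t) →
  ν ρ P S (t ∷ʳ d) ≡ ∑[ x ← elements S ] ⟦ ρ (P ∪ S) ∸ ρ (P ∪ (S - x)) ℕ.≟ toℕ d ⟧ * ν ρ P (S - x) t
ν-∷ʳ ρ P S [] d ∣S∣≡1 = ∑-cong (elements S) λ {x} x∈ →
  let x∈S = ∈-elements⁻ S x∈
      ∣S-x∣≡0 = ℕ.suc-injective (trans (sym (size-remove S x∈S)) ∣S∣≡1)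
  in cong₂ (λ A B → ⟦ ρ A ∸ ρ B ℕ.≟ toℕ d ⟧ * 1)
           (trans (sym (∪-empty (P ∪ ⁅ x ⁆) ∣S-x∣≡0)) (move-element P S x∈S))
           (sym (∪-empty P ∣S-x∣≡0))
ν-∷ʳ ρ P S (e ∷ t) d ∣S∣≡ = begin
  (∑[ y ← elements S ] [ y ] * ν ρ (P ∪ ⁅ y ⁆) (S - y) (t ∷ʳ d))
    ≡⟨ ∑-cong (elements S) (λ {y} y∈ → let y∈S = ∈-elements⁻ S y∈ in cong ([ y ] *_) (trans
         (ν-∷ʳ ρ (P ∪ ⁅ y ⁆) (S - y) t d
           (ℕ.suc-injective (trans (sym (size-remove S y∈S)) ∣S∣≡)))
         (∑-cong (elements (S - y)) λ {x} x∈ → cong₂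
            (λ A B → ⟦ ρ A ∸ ρ B ℕ.≟ toℕ d ⟧ * ν ρ (P ∪ ⁅ y ⁆) (S - y - x) t)
            (move-element P S y∈S)
            (trans (cong ((P ∪ ⁅ y ⁆) ∪_) (p─x─y≡p─y─x S y x))
                   (move-element P (S - x) (x∈p∧x≢y⇒x∈p-y y∈S
                     λ { refl → x∈p─q⇒x∉q S ⁅ x ⁆ (∈-elements⁻ (S - y) x∈) (x∈⁅x⁆ x) })))))) ⟩
  (∑[ y ← elements S ] [ y ] * (∑[ x ← elements (S - y) ] < x > * ν ρ (P ∪ ⁅ y ⁆) (S - y - x) t))
    ≡⟨ ∑-cong (elements S) (λ {y} _ → sym (∑-*ˡ (elements (S - y)) [ y ] _)) ⟩
  (∑[ y ← elements S ] ∑[ x ← elements (S - y) ] [ y ] * (< x > * ν ρ (P ∪ ⁅ y ⁆) (S - y - x) t))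
    ≡⟨ ∑-elements-swap S _ ⟩
  (∑[ x ← elements S ] ∑[ y ← elements (S - x) ] [ y ] * (< x > * ν ρ (P ∪ ⁅ y ⁆) (S - y - x) t))
    ≡⟨ ∑-cong (elements S) (λ {x} _ → ∑-cong (elements (S - x)) λ {y} _ → trans
         (cong (λ A → [ y ] * (< x > * ν ρ (P ∪ ⁅ y ⁆) A t)) (p─x─y≡p─y─x S y x))
         (*-exchange [ y ] < x > _)) ⟩
  (∑[ x ← elements S ] ∑[ y ← elements (S - x) ] < x > * ([ y ] * ν ρ (P ∪ ⁅ y ⁆) (S - x - y) t))
    ≡⟨ ∑-cong (elements S) (λ {x} _ → ∑-*ˡ (elements (S - x)) < x > _) ⟩
  (∑[ x ← elements S ] < x > * ν ρ P (S - x) (e ∷ t)) ∎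
  where
  open ≡-Reasoning
  [_] <_> : Fin _ → ℕ
  [ y ] = ⟦ step ρ P y ℕ.≟ toℕ e ⟧
  < x > = ⟦ ρ (P ∪ S) ∸ ρ (P ∪ (S - x)) ℕ.≟ toℕ d ⟧

-- Counts for the rank function of a matroid

module _ (M : Matroid m) where

  open Matroid M

  step≤1 : ∀ {P S x} → P ∪ S ⊆ E → x ∈ S → step rank P x ≤ 1
  step≤1 {P} {S} {x} PS⊆E x∈S =
    ℕ.≤-trans (ℕ.∸-monoˡ-≤ (rank P) (unit-increase M P x
                (∪⁅⁆-⊆ (PS⊆E ∘ p⊆p∪q S) (PS⊆E (q⊆p∪q P S x∈S)))))
              (ℕ.≤-reflexive (ℕ.m+n∸n≡m 1 (rank P)))

  rank-step : ∀ {P x d} → P ⊆ E → x ∈ E → step rank P x ≡ d → rank (P ∪ ⁅ x ⁆) ≡ rank P + d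
  rank-step {P} {x} P⊆E x∈E refl =
    sym (ℕ.m+[n∸m]≡n (monotone (p⊆p∪q ⁅ x ⁆) (∪⁅⁆-⊆ P⊆E x∈E)))

  -- An arrangement can be prolonged by each of the `∣ S ∣ ∸ length t` elements it leaves over, and
  -- by submodularity the new increment is 0 or 1. If nothing is left over, both sides are 0, so the
  -- truncated subtraction is harmless.
  ν-extend : ∀ P S t → P ∪ S ⊆ E →
    ν rank P S (t ∷ʳ 0F) + ν rank P S (t ∷ʳ 1F) ≡ (∣ S ∣ ∸ length t) * ν rank P S t
  ν-extend P S [] PS⊆E = begin
    ν rank P S (0F ∷ []) + ν rank P S (1F ∷ []) ≡⟨ ∑-+ (elements S) _ _ ⟨
    (∑[ x ← elements S ] (⟦ step rank P x ℕ.≟ 0 ⟧ * 1 + ⟦ step rank P x ℕ.≟ 1 ⟧ * 1))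
      ≡⟨ ∑-cong (elements S) (λ {x} x∈ → trans
           (sym (ℕ.*-distribʳ-+ 1 ⟦ step rank P x ℕ.≟ 0 ⟧ ⟦ step rank P x ℕ.≟ 1 ⟧))
           (trans (ℕ.*-identityʳ _) (⟦≟0⟧+⟦≟1⟧ (step≤1 PS⊆E (∈-elements⁻ S x∈))))) ⟩
    (∑[ _ ← elements S ] 1) ≡⟨ ∑-elements-1 S ⟩
    ∣ S ∣                   ≡⟨ ℕ.*-identityʳ ∣ S ∣ ⟨
    ∣ S ∣ * 1               ∎
    where open ≡-Reasoning
  ν-extend P S (d ∷ t) PS⊆E = begin
    ν rank P S (d ∷ t ∷ʳ 0F) + ν rank P S (d ∷ t ∷ʳ 1F) ≡⟨ ∑-+ (elements S) _ _ ⟨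
    (∑[ x ← elements S ] ([ x ] * N x (t ∷ʳ 0F) + [ x ] * N x (t ∷ʳ 1F)))
      ≡⟨ ∑-cong (elements S) (λ {x} x∈ → let x∈S = ∈-elements⁻ S x∈ in begin
           [ x ] * N x (t ∷ʳ 0F) + [ x ] * N x (t ∷ʳ 1F) ≡⟨ ℕ.*-distribˡ-+ [ x ] _ _ ⟨
           [ x ] * (N x (t ∷ʳ 0F) + N x (t ∷ʳ 1F))
             ≡⟨ cong ([ x ] *_) (ν-extend (P ∪ ⁅ x ⁆) (S - x) t
                  (PS⊆E ∘ subst (_ ∈_) (move-element P S x∈S))) ⟩
           [ x ] * ((∣ S - x ∣ ∸ length t) * N x t)
             ≡⟨ cong (λ k → [ x ] * ((k ∸ length (d ∷ t)) * N x t)) (size-remove S x∈S) ⟨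
           [ x ] * (K * N x t) ≡⟨ *-exchange [ x ] K _ ⟩
           K * ([ x ] * N x t) ∎) ⟩
    (∑[ x ← elements S ] K * ([ x ] * N x t))
      ≡⟨ ∑-*ˡ (elements S) K _ ⟩
    K * ν rank P S (d ∷ t) ∎
    where
    open ≡-Reasoning
    K : ℕ
    K = ∣ S ∣ ∸ length (d ∷ t)
    N : Fin _ → Word → ℕ
    N x = ν rank (P ∪ ⁅ x ⁆) (S - x)
    [_] : Fin _ → ℕ
    [ x ] = ⟦ step rank P x ℕ.≟ toℕ d ⟧

  ν-∷-zero : ∀ {P S d} t → P ∪ S ⊆ E →
    (∀ {x} → x ∈ S → rank (P ∪ ⁅ x ⁆) ≡ rank P + toℕ d → (P ∪ ⁅ x ⁆) ∪ (S - x) ⊆ E →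
      ν rank (P ∪ ⁅ x ⁆) (S - x) t ≡ 0) →
    ν rank P S (d ∷ t) ≡ 0
  ν-∷-zero {P} {S} {d} t PS⊆E ν≡0 = ∑-zero (elements S) λ {x} x∈ → let x∈S = ∈-elements⁻ S x∈ in
    trans (⟦⟧*-congʳ (step rank P x ℕ.≟ toℕ d) (λ eq → ν≡0 x∈S
            (rank-step (PS⊆E ∘ p⊆p∪q S) (PS⊆E (q⊆p∪q P S x∈S)) eq)
            (PS⊆E ∘ subst (_ ∈_) (move-element P S x∈S))))
          (ℕ.*-zeroʳ ⟦ step rank P x ℕ.≟ toℕ d ⟧)

  -- The increments of a counted arrangement sum to `ones t`, yet it never leaves `P ∪ S`.
  ν-rank-exceeded : ∀ P S t → P ∪ S ⊆ E → rank (P ∪ S) < rank P + ones t → ν rank P S t ≡ 0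
  ν-rank-exceeded P S [] PS⊆E r< =
    contradiction (monotone (p⊆p∪q S) PS⊆E)
      (ℕ.<⇒≱ (subst (rank (P ∪ S) <_) (ℕ.+-identityʳ (rank P)) r<))
  ν-rank-exceeded P S (d ∷ t) PS⊆E r< = ν-∷-zero t PS⊆E λ {x} x∈S eq ⊆E →
    ν-rank-exceeded (P ∪ ⁅ x ⁆) (S - x) t ⊆E
      (subst₂ _<_ (cong rank (sym (move-element P S x∈S)))
        (trans (cong (rank P +_) (ones-∷ d t))
          (trans (sym (ℕ.+-assoc (rank P) _ _)) (cong (_+ ones t) (sym eq)))) r<)

  -- Here the word exhausts `S`, so a counted arrangement ends exactly at `P ∪ S` and its increments
  -- must add up to the full difference of ranks.
  ν-rank-mismatch : ∀ P S t → P ∪ S ⊆ E → length t ≡ ∣ S ∣ → rank P + ones t ≢ rank (P ∪ S) →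
                    ν rank P S t ≡ 0
  ν-rank-mismatch P S [] PS⊆E ∣S∣≡0 r≢ = contradiction
    (trans (ℕ.+-identityʳ (rank P)) (cong rank (sym (∪-empty P (sym ∣S∣≡0))))) r≢
  ν-rank-mismatch P S (d ∷ t) PS⊆E ∣S∣≡ r≢ = ν-∷-zero t PS⊆E λ {x} x∈S eq ⊆E →
    ν-rank-mismatch (P ∪ ⁅ x ⁆) (S - x) t ⊆E
      (ℕ.suc-injective (trans ∣S∣≡ (size-remove S x∈S)))
      λ eq′ → r≢ (begin
        rank P + ones (d ∷ t)      ≡⟨ cong (rank P +_) (ones-∷ d t) ⟩
        rank P + (toℕ d + ones t)  ≡⟨ ℕ.+-assoc (rank P) _ _ ⟨
        rank P + toℕ d + ones t    ≡⟨ cong (_+ ones t) eq ⟨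
        rank (P ∪ ⁅ x ⁆) + ones t  ≡⟨ eq′ ⟩
        rank ((P ∪ ⁅ x ⁆) ∪ (S - x)) ≡⟨ cong rank (move-element P S x∈S) ⟩
        rank (P ∪ S)               ∎)
    where open ≡-Reasoning

-- Recovering size and counts from the words with r − 1 ones

length-∷ʳ : ∀ {a} {A : Set a} (xs : List A) x → length (xs ∷ʳ x) ≡ suc (length xs)
length-∷ʳ xs x = trans (length-++ xs) (ℕ.+-comm (length xs) 1)

-- An abstraction of the counts of a rank `r` matroid on `n` elements. It mentions no ground set, so
-- counts of different matroids can be compared, and it serves restrictions and duals alike.
record Profile (n r : ℕ) (F : Word → ℕ) : Set where
  field
    empty         : F [] ≡ 1
    extend        : ∀ t → F (t ∷ʳ 0F) + F (t ∷ʳ 1F) ≡ (n ∸ length t) * F t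
    long          : ∀ t → n < length t → F t ≡ 0
    rank-exceeded : ∀ t → r < ones t → F t ≡ 0
    rank-mismatch : ∀ t → length t ≡ n → ones t ≢ r → F t ≡ 0

module _ (k : ℕ) where

  -- With j elements left after t, total F j t counts the completions to full
  -- orderings, split by the prefix at which the k-th one appears.  It reads
  -- F only at words with exactly k ones.

  total  : (Word → ℕ) → ℕ → Word → ℕ
  total′ : (F : Word → ℕ) (j : ℕ) (t : Word) → Dec (ones t ≡ k) → ℕ
  total F j t = total′ F j t (ones t ℕ.≟ k)
  total′ F j       t (yes _) = j ! * F t
  total′ F zero    t (no _)  = 0
  total′ F (suc j) t (no _)  = total F j (t ∷ʳ 0F) + total F j (t ∷ʳ 1F)

  AgreeAt : (F F′ : Word → ℕ) → Set
  AgreeAt F F′ = ∀ t → ones t ≡ k → F t ≡ F′ t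

  total-cong : ∀ {F F′} → AgreeAt F F′ → ∀ j t → total F j t ≡ total F′ j t
  total-cong F≡F′ j t with ones t ℕ.≟ k
  total-cong F≡F′ j       t | yes eq = cong (j ! *_) (F≡F′ t eq)
  total-cong F≡F′ zero    t | no _   = refl
  total-cong F≡F′ (suc j) t | no _   =
    cong₂ _+_ (total-cong F≡F′ j (t ∷ʳ 0F)) (total-cong F≡F′ j (t ∷ʳ 1F))

  total-zero : ∀ {F n} → (∀ t → n < length t → F t ≡ 0) → ∀ j t → n < length t → total F j t ≡ 0
  total-zero long j t n< with ones t ℕ.≟ k
  total-zero long j       t n< | yes _ = trans (cong (j ! *_) (long t n<)) (ℕ.*-zeroʳ (j !))
  total-zero long zero    t n< | no _  = refl
  total-zero long (suc j) t n< | no _  = cong₂ _+_ (go 0F) (go 1F)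
    where
    go : ∀ d → total _ j (t ∷ʳ d) ≡ 0
    go d = total-zero long j (t ∷ʳ d) (subst (_ <_) (sym (length-∷ʳ t d)) (ℕ.m<n⇒m<1+n n<))

  module _ {n r F} (prof : Profile n r F) (k<r : k < r) where

    open Profile prof

    -- At an inner node `extend` merges the two branches into `suc j * F t`, which builds the
    -- factorial up one factor at a time. The bound `ones t ≤ k` ensures that the cut at `k` ones
    -- still lies ahead.
    total-exact : ∀ j t → length t + j ≡ n → ones t ≤ k → total F j t ≡ j ! * F t
    total-exact j t eq ones≤k with ones t ℕ.≟ k
    total-exact j       t eq ones≤k | yes _ = refl
    -- A full-length word with at most `k < r` ones is spelled by no ordering, so the default value
    -- 0 of `total′` is the correct one.
    total-exact zero    t eq ones≤k | no _  = sym (trans (ℕ.*-identityˡ (F t))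
      (rank-mismatch t (trans (sym (ℕ.+-identityʳ _)) eq)
        (ℕ.<⇒≢ (ℕ.≤-<-trans ones≤k k<r))))
    total-exact (suc j) t eq ones≤k | no ones≢k = begin
      total F j (t ∷ʳ 0F) + total F j (t ∷ʳ 1F)   ≡⟨ cong₂ _+_ (go 0F) (go 1F) ⟩
      j ! * F (t ∷ʳ 0F) + j ! * F (t ∷ʳ 1F)       ≡⟨ ℕ.*-distribˡ-+ (j !) _ _ ⟨
      j ! * (F (t ∷ʳ 0F) + F (t ∷ʳ 1F))           ≡⟨ cong (j ! *_) (extend t) ⟩
      j ! * ((n ∸ length t) * F t)
        ≡⟨ cong (λ n → j ! * ((n ∸ length t) * F t)) eq ⟨
      j ! * ((length t + suc j ∸ length t) * F t)
        ≡⟨ cong (λ i → j ! * (i * F t)) (ℕ.m+n∸m≡n (length t) (suc j)) ⟩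
      j ! * (suc j * F t)                         ≡⟨ ℕ.*-assoc (j !) (suc j) (F t) ⟨
      j ! * suc j * F t                           ≡⟨ cong (_* F t) (ℕ.*-comm (j !) (suc j)) ⟩
      suc j ! * F t                               ∎
      where
      open ≡-Reasoning
      go : ∀ d → total F j (t ∷ʳ d) ≡ j ! * F (t ∷ʳ d)
      go d = total-exact j (t ∷ʳ d)
        (trans (cong (_+ j) (length-∷ʳ t d)) (trans (sym (ℕ.+-suc (length t) j)) eq))
        (subst (_≤ k) (sym (ones-∷ʳ t d)) (ones+d d))
        where
        ones<k : ones t < k
        ones<k = ℕ.≤∧≢⇒< ones≤k ones≢k
        ones+d : ∀ d → ones t + toℕ d ≤ k
        ones+d 0F = ℕ.≤-trans (ℕ.≤-reflexive (ℕ.+-identityʳ _)) ones≤k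
        ones+d 1F = ℕ.≤-trans (ℕ.≤-reflexive (ℕ.+-comm _ 1)) ones<k

    total-[] : total F n [] ≡ n !
    total-[] = trans (total-exact n [] refl z≤n)
                     (trans (cong (n ! *_) empty) (ℕ.*-identityʳ (n !)))


  -- For `∣t∣ = suc p`, `n = suc p + j` and `n′ = n + suc d` this is
  -- `(n′ − ∣t∣)! / n′! < (n − ∣t∣)! / n!`, cross-multiplied and with the gap `j !`. Lengthening `t`
  -- by one letter with `j` fixed multiplies the left product by the new `n` and the right one by
  -- the larger new `n′`. For empty `t` the two ratios would coincide, whence `suc p`.
  factorial-inequality : ∀ p j d → (j + suc d) ! * (suc p + j) ! + j ! ≤ j ! * (suc p + j + suc d) !
  factorial-inequality zero j d = begin
    X * ((1 + j) * j !) + j !       ≤⟨ ℕ.+-monoʳ-≤ _ (ℕ.m≤n*m (j !) X {{ℕ._!≢0 (j + suc d)}}) ⟩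
    X * ((1 + j) * j !) + X * j !   ≤⟨ ℕ.m≤m+n _ (j ! * (d * X)) ⟩
    X * ((1 + j) * j !) + X * j ! + j ! * (d * X)
      ≡⟨ solve 4 (λ x f j d → x :* ((con 1 :+ j) :* f) :+ x :* f :+ f :* (d :* x)
                   := f :* ((con 1 :+ (j :+ (con 1 :+ d))) :* x)) refl X (j !) j d ⟩
    j ! * ((1 + (j + suc d)) * X)   ∎
    where
    open ℕ.≤-Reasoning
    open +-*-Solver
    X : ℕ
    X = (j + suc d) !
  factorial-inequality (suc p) j d = begin
    X * (s * Y) + j !       ≤⟨ ℕ.+-monoʳ-≤ _ (ℕ.m≤n*m (j !) s) ⟩
    X * (s * Y) + s * j !
      ≡⟨ solve 4 (λ x y f s → x :* (s :* y) :+ s :* f := s :* (x :* y :+ f)) refl X Y (j !) s ⟩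
    s * (X * Y + j !)       ≤⟨ ℕ.*-mono-≤ (ℕ.m≤m+n s (suc d)) (factorial-inequality p j d) ⟩
    (s + suc d) * (j ! * Z) ≡⟨ *-exchange (s + suc d) (j !) Z ⟩
    j ! * ((s + suc d) * Z) ∎
    where
    open ℕ.≤-Reasoning
    open +-*-Solver
    s X Y Z : ℕ
    s = suc (suc p + j)
    X = (j + suc d) !
    Y = (suc p + j) !
    Z = (suc p + j + suc d) !

  -- total F (n − ∣t∣) t / n ! decreases strictly in n.  Strictness is the
  -- additive term total F j t: it is homogeneous in F, hence survives the
  -- summation over the leaves, some of which vanish.

  total-decreasing : ∀ {F n} → (∀ t → n < length t → F t ≡ 0) →
    ∀ d j t → length t + j ≡ n → (ones t ≡ k → 1 ≤ length t) →
    total F (j + suc d) t * n ! + total F j t ≤ total F j t * (n + suc d) !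
  total-decreasing long d j t eq pos with ones t ℕ.≟ k
  total-decreasing {F} long d j t refl pos | yes e with length t | pos e
  ... | suc p | _ = begin
    (j + suc d) ! * F t * (suc p + j) ! + j ! * F t
      ≡⟨ solve 4 (λ a f b c → a :* f :* b :+ c :* f := (a :* b :+ c) :* f) refl
           ((j + suc d) !) (F t) ((suc p + j) !) (j !) ⟩
    ((j + suc d) ! * (suc p + j) ! + j !) * F t ≤⟨ ℕ.*-monoˡ-≤ (F t) (factorial-inequality p j d) ⟩
    j ! * (suc p + j + suc d) ! * F t
      ≡⟨ solve 3 (λ a f b → a :* b :* f := a :* f :* b) refl (j !) (F t) ((suc p + j + suc d) !) ⟩
    j ! * F t * (suc p + j + suc d) ! ∎
    where
    open ℕ.≤-Reasoning
    open +-*-Solver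
  -- Now `t` has length `n` and fewer or more than `k` ones: the right side is 0 by default, and on
  -- the left every extension of `t` is longer than `n` and is killed by `long`.
  total-decreasing {F} {n} long d zero t eq pos | no _ = ℕ.≤-reflexive
    (trans (ℕ.+-identityʳ _) (cong (_* n !) (cong₂ _+_ (go 0F) (go 1F))))
    where
    go : ∀ e → total F d (t ∷ʳ e) ≡ 0
    go e = total-zero long d (t ∷ʳ e)
      (ℕ.≤-reflexive (trans (cong suc (trans (sym eq) (ℕ.+-identityʳ _))) (sym (length-∷ʳ t e))))
  total-decreasing {F} {n} long d (suc j) t eq pos | no _ = begin
    (T (j + suc d) 0F + T (j + suc d) 1F) * n ! + (T j 0F + T j 1F)
      ≡⟨ solve 5 (λ a b c d n → (a :+ b) :* n :+ (c :+ d) := (a :* n :+ c) :+ (b :* n :+ d)) refl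
           (T (j + suc d) 0F) (T (j + suc d) 1F) (T j 0F) (T j 1F) (n !) ⟩
    (T (j + suc d) 0F * n ! + T j 0F) + (T (j + suc d) 1F * n ! + T j 1F)
      ≤⟨ ℕ.+-mono-≤ (go 0F) (go 1F) ⟩
    T j 0F * (n + suc d) ! + T j 1F * (n + suc d) !
      ≡⟨ ℕ.*-distribʳ-+ ((n + suc d) !) (T j 0F) (T j 1F) ⟨
    (T j 0F + T j 1F) * (n + suc d) ! ∎
    where
    open ℕ.≤-Reasoning
    open +-*-Solver
    T : ℕ → Fin 2 → ℕ
    T i e = total F i (t ∷ʳ e)
    go : ∀ e → T (j + suc d) e * n ! + T j e ≤ T j e * (n + suc d) !
    go e = total-decreasing long d j (t ∷ʳ e)
      (trans (cong (_+ j) (length-∷ʳ t e)) (trans (sym (ℕ.+-suc (length t) j)) eq))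
      (λ _ → subst (1 ≤_) (sym (length-∷ʳ t e)) (s≤s z≤n))

  module _ {n n′ r r′ F F′} (prof : Profile n r F) (prof′ : Profile n′ r′ F′)
           (k<r : k < r) (k<r′ : k < r′) (0<k : 0 < k) (F≡F′ : AgreeAt F F′) where

    -- `total F n′ []` reads `F` with the wrong size, but only at words where `F` and `F′` agree, so
    -- it equals `n′ !`. The ratio of `total` to the factorial would then be 1 at both `n` and `n′`,
    -- against its strict decrease.
    size≮ : ¬ n < n′
    size≮ n<n′ with d , refl ← ℕ.m≤n⇒∃[o]m+o≡n n<n′ =
      ℕ.<⇒≱ (ℕ.m<m+n (n ! * (n + suc d) !) (ℕ.1≤n! n)) (begin
        n ! * (n + suc d) ! + n ! ≡⟨ cong (_+ n !) (ℕ.*-comm (n !) ((n + suc d) !)) ⟩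
        (n + suc d) ! * n ! + n ! ≡⟨ cong₂ (λ a b → a * n ! + b) (sym T′) (sym T) ⟩
        total F (n + suc d) [] * n ! + total F n []
          -- As `0 < k`, the empty word is not a leaf; a leaf of length 0 would make the ratio
          -- constant.
          ≤⟨ total-decreasing (Profile.long prof) d n [] refl
               (λ eq → contradiction 0<k (ℕ.<-irrefl eq)) ⟩
        total F n [] * (n + suc d) ! ≡⟨ cong (_* (n + suc d) !) T ⟩
        n ! * (n + suc d) !          ∎)
      where
      open ℕ.≤-Reasoning
      T : total F n [] ≡ n !
      T = total-[] prof k<r
      T′ : total F (n + suc d) [] ≡ (n + suc d) !
      T′ = trans (total-cong F≡F′ (n + suc d) [])
        (subst (λ i → total F′ i [] ≡ i !) (sym (ℕ.+-suc n d)) (total-[] prof′ k<r′))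

  -- Each of the `n !` orderings passes through rank `k` on its way to `r`, so some word with `k`
  -- ones is spelled. This is what prevents decks of matroids of different ranks from agreeing.
  profile-nonzero : ∀ {n r F} → Profile n r F → k < r → ¬ (∀ t → ones t ≡ k → F t ≡ 0)
  profile-nonzero {n} {F = F} prof k<r F≡0 = ℕ.<⇒≢ (ℕ.1≤n! n) (sym (begin
    n !                   ≡⟨ total-[] prof k<r ⟨
    total F n []          ≡⟨ total-cong F≡0 n [] ⟩
    total (λ _ → 0) n []  ≡⟨ total-vanish n [] ⟩
    0                     ∎))
    where
    open ≡-Reasoning
    total-vanish : ∀ j t → total (λ _ → 0) j t ≡ 0
    total-vanish j t with ones t ℕ.≟ k
    total-vanish j       t | yes _ = ℕ.*-zeroʳ (j !)
    total-vanish zero    t | no _  = refl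
    total-vanish (suc j) t | no _  = cong₂ _+_ (total-vanish j (t ∷ʳ 0F)) (total-vanish j (t ∷ʳ 1F))

module _ {k n n′ F F′} (prof : Profile n (suc k) F) (prof′ : Profile n′ (suc k) F′)
         (0<k : 0 < k) (F≡F′ : AgreeAt k F F′) where

  profile-size : n ≡ n′
  profile-size with ℕ.<-cmp n n′
  ... | tri< n<n′ _ _ = contradiction n<n′ (size≮ k prof prof′ ℕ.≤-refl ℕ.≤-refl 0<k F≡F′)
  ... | tri≈ _ n≡n′ _ = n≡n′
  ... | tri> _ _ n>n′ = contradiction n>n′
    (size≮ k prof′ prof ℕ.≤-refl ℕ.≤-refl 0<k λ t e → sym (F≡F′ t e))

  private
    module P  = Profile prof
    module P′ = Profile prof′

  -- Induction on the last letter, with `extend` supplying one equation for two unknowns. For `t0`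
  -- the sibling `t1` has too many ones and vanishes, and `t` is settled by induction; for `t1` both
  -- `t` and the sibling `t0` have `k` ones and are given.
  profile-agree : AgreeAt (suc k) F F′
  profile-agree t = go t (reverseView t)
    where
    go : ∀ t → Reverse t → ones t ≡ suc k → F t ≡ F′ t
    go .[]           []            eq = contradiction eq λ ()
    go .(t ∷ʳ 0F) (t ∶ rs ∶ʳ 0F) eq = ℕ.+-cancelʳ-≡ 0 _ _ (begin
      F (t ∷ʳ 0F) + 0                 ≡⟨ cong (F (t ∷ʳ 0F) +_) (P.rank-exceeded (t ∷ʳ 1F) r<) ⟨
      F (t ∷ʳ 0F) + F (t ∷ʳ 1F)       ≡⟨ P.extend t ⟩
      (n ∸ length t) * F t
        ≡⟨ cong₂ (λ n x → (n ∸ length t) * x) profile-size (go t rs ones-t) ⟩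
      (n′ ∸ length t) * F′ t          ≡⟨ P′.extend t ⟨
      F′ (t ∷ʳ 0F) + F′ (t ∷ʳ 1F)     ≡⟨ cong (F′ (t ∷ʳ 0F) +_) (P′.rank-exceeded (t ∷ʳ 1F) r<) ⟩
      F′ (t ∷ʳ 0F) + 0                ∎)
      where
      open ≡-Reasoning
      ones-t : ones t ≡ suc k
      ones-t = trans (sym (trans (ones-∷ʳ t 0F) (ℕ.+-identityʳ _))) eq
      r< : suc k < ones (t ∷ʳ 1F)
      r< = ℕ.≤-reflexive (sym (trans (ones-∷ʳ t 1F) (trans (ℕ.+-comm _ 1) (cong suc ones-t))))
    go .(t ∷ʳ 1F) (t ∶ rs ∶ʳ 1F) eq = ℕ.+-cancelˡ-≡ (F (t ∷ʳ 0F)) _ _ (begin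
      F (t ∷ʳ 0F) + F (t ∷ʳ 1F)       ≡⟨ P.extend t ⟩
      (n ∸ length t) * F t
        ≡⟨ cong₂ (λ n x → (n ∸ length t) * x) profile-size (F≡F′ t ones-t) ⟩
      (n′ ∸ length t) * F′ t          ≡⟨ P′.extend t ⟨
      F′ (t ∷ʳ 0F) + F′ (t ∷ʳ 1F)
        ≡⟨ cong (_+ F′ (t ∷ʳ 1F)) (F≡F′ (t ∷ʳ 0F)
             (trans (ones-∷ʳ t 0F) (trans (ℕ.+-identityʳ _) ones-t))) ⟨
      F (t ∷ʳ 0F) + F′ (t ∷ʳ 1F)      ∎)
      where
      open ≡-Reasoning
      ones-t : ones t ≡ k
      ones-t = ℕ.suc-injective (trans (sym (trans (ones-∷ʳ t 1F) (ℕ.+-comm _ 1))) eq)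

-- Copoints

∈-allSubsets : (S : Subset m) → S ∈ˡ allSubsets m
∈-allSubsets []            = here refl
∈-allSubsets (outside ∷ S) = ∈-++⁺ˡ (∈-map⁺ (outside ∷_) (∈-allSubsets S))
∈-allSubsets {suc m} (inside  ∷ S) =
  ∈-++⁺ʳ (map (outside ∷_) (allSubsets m)) (∈-map⁺ (inside ∷_) (∈-allSubsets S))

allSubsets-unique : ∀ m → Unique (allSubsets m)
allSubsets-unique zero    = [] ∷ []
allSubsets-unique (suc m) = Unique.++⁺
  (Unique.map⁺ Vec.∷-injectiveʳ (allSubsets-unique m))
  (Unique.map⁺ Vec.∷-injectiveʳ (allSubsets-unique m))
  disjoint
  where
  disjoint : ∀ {S} → S ∈ˡ map (outside ∷_) (allSubsets m) × S ∈ˡ map (inside ∷_) (allSubsets m) → _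
  disjoint (S∈ , S∈′)
    with _ , _ , refl ← ∈-map⁻ (outside ∷_) S∈
    with _ , _ , ()   ← ∈-map⁻ (inside ∷_) S∈′

-- When `t` has reached full rank, `t1` vanishes and `extend` yields one factor of `j !` per
-- appended zero: the remaining elements may follow in any order.
trailing-zeros : ∀ {n r F} → Profile n r F → ∀ j t → ones t ≡ r → length t + j ≡ n →
                 F (t ++ replicate j 0F) ≡ j ! * F t
trailing-zeros {F = F} prof zero t ones≡ len =
  trans (cong F (++-identityʳ t)) (sym (ℕ.*-identityˡ (F t)))
trailing-zeros {n} {r} {F} prof (suc j) t ones≡ len = begin
  F (t ++ 0F ∷ replicate j 0F)   ≡⟨ cong F (++-assoc t (0F ∷ []) (replicate j 0F)) ⟨
  F ((t ∷ʳ 0F) ++ replicate j 0F)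
    ≡⟨ trailing-zeros prof j (t ∷ʳ 0F)
         (trans (ones-∷ʳ t 0F) (trans (ℕ.+-identityʳ _) ones≡))
         (trans (cong (_+ j) (length-∷ʳ t 0F)) (trans (sym (ℕ.+-suc (length t) j)) len)) ⟩
  j ! * F (t ∷ʳ 0F)              ≡⟨ cong (j ! *_) F-t0 ⟩
  j ! * (suc j * F t)            ≡⟨ ℕ.*-assoc (j !) (suc j) (F t) ⟨
  j ! * suc j * F t              ≡⟨ cong (_* F t) (ℕ.*-comm (j !) (suc j)) ⟩
  suc j ! * F t                  ∎
  where
  open ≡-Reasoning
  open Profile prof
  F-t0 : F (t ∷ʳ 0F) ≡ suc j * F t
  F-t0 = begin
    F (t ∷ʳ 0F)                      ≡⟨ ℕ.+-identityʳ _ ⟨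
    F (t ∷ʳ 0F) + 0                  ≡⟨ cong (F (t ∷ʳ 0F) +_) (rank-exceeded (t ∷ʳ 1F)
      (ℕ.≤-reflexive (sym (trans (ones-∷ʳ t 1F) (trans (ℕ.+-comm _ 1) (cong suc ones≡)))))) ⟨
    F (t ∷ʳ 0F) + F (t ∷ʳ 1F)        ≡⟨ extend t ⟩
    (n ∸ length t) * F t             ≡⟨ cong (λ n → (n ∸ length t) * F t) len ⟨
    (length t + suc j ∸ length t) * F t ≡⟨ cong (_* F t) (ℕ.m+n∸m≡n (length t) (suc j)) ⟩
    suc j * F t                      ∎

module _ (M : Matroid m) where

  open Matroid M

  rank-⊥ : rank ⊥ ≡ 0
  rank-⊥ = ℕ.n≤0⇒n≡0 (subst (rank ⊥ ≤_) (∣⊥∣≡0 m) (rank≤size ⊥⊆))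

  profile : Profile size matroidRank (ν rank ⊥ E)
  profile = record
    { empty         = refl
    ; extend        = λ t → ν-extend M ⊥ E t ⊥∪E⊆E
    ; long          = ν-long rank ⊥ E
    ; rank-exceeded = λ t r< → ν-rank-exceeded M ⊥ E t ⊥∪E⊆E
        (subst₂ _<_ (cong rank (sym (∪-identityˡ E))) (cong (_+ ones t) (sym rank-⊥)) r<)
    ; rank-mismatch = λ t len r≢ → ν-rank-mismatch M ⊥ E t ⊥∪E⊆E len
        λ eq → r≢ (trans (cong (_+ ones t) (sym rank-⊥)) (trans eq (cong rank (∪-identityˡ E))))
    }
    where
    ⊥∪E⊆E : ⊥ ∪ E ⊆ E
    ⊥∪E⊆E = ∪-least ⊥⊆ id


module _ (M : Matroid m) where

  open Matroid M

  -- Submodularity for `P ∪ ⁅ x ⁆` and `P ∪ (Q - x)`: both have the rank of `P`, and their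
  -- intersection contains `P`. The size `k` is an argument to make the recursion structural.
  rank-∪-spanned : ∀ k {P Q} → ∣ Q ∣ ≡ k → P ⊆ E → Q ⊆ E →
                   (∀ {x} → x ∈ Q → rank (P ∪ ⁅ x ⁆) ≡ rank P) → rank (P ∪ Q) ≡ rank P
  rank-∪-spanned zero    {P} ∣Q∣≡0 P⊆E Q⊆E spanned = cong rank (∪-empty P ∣Q∣≡0)
  rank-∪-spanned (suc k) {P} {Q} ∣Q∣≡ P⊆E Q⊆E spanned with nonempty? Q
  ... | no empty = contradiction
    (trans (sym ∣Q∣≡) (trans (cong ∣_∣ (Empty-unique empty)) (∣⊥∣≡0 m))) λ ()
  ... | yes (x , x∈Q) = ℕ.≤-antisym
    (ℕ.+-cancelʳ-≤ (rank P) _ _ (begin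
      rank (P ∪ Q) + rank P
        ≤⟨ ℕ.+-mono-≤ (monotone (subst (_⊆ (P ∪ ⁅ x ⁆) ∪ (P ∪ (Q - x))) (move-element P Q x∈Q)
                         (∪-least (p⊆p∪q _) (q⊆p∪q (P ∪ ⁅ x ⁆) _ ∘ q⊆p∪q P (Q - x))))
                       (∪-least Px⊆E PQx⊆E))
                      (monotone (λ y∈ → x∈p∩q⁺ (p⊆p∪q _ y∈ , p⊆p∪q _ y∈))
                       (Px⊆E ∘ p∩q⊆p _ _)) ⟩
      rank ((P ∪ ⁅ x ⁆) ∪ (P ∪ (Q - x))) + rank ((P ∪ ⁅ x ⁆) ∩ (P ∪ (Q - x)))
        ≤⟨ submodular Px⊆E PQx⊆E ⟩
      rank (P ∪ ⁅ x ⁆) + rank (P ∪ (Q - x))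
        ≡⟨ cong₂ _+_ (spanned x∈Q)
             (rank-∪-spanned k (ℕ.suc-injective (trans (sym (size-remove Q x∈Q)) ∣Q∣≡)) P⊆E
               (Q⊆E ∘ Q-x⊆Q) (spanned ∘ Q-x⊆Q)) ⟩
      rank P + rank P ∎))
    (monotone (p⊆p∪q Q) (∪-least P⊆E Q⊆E))
    where
    open ℕ.≤-Reasoning
    Q-x⊆Q : Q - x ⊆ Q
    Q-x⊆Q = p─q⊆p Q ⁅ x ⁆
    Px⊆E : P ∪ ⁅ x ⁆ ⊆ E
    Px⊆E = ∪⁅⁆-⊆ P⊆E (Q⊆E x∈Q)
    PQx⊆E : P ∪ (Q - x) ⊆ E
    PQx⊆E = ∪-least P⊆E (Q⊆E ∘ Q-x⊆Q)

  spanned? : ∀ P x → Dec (x ∈ E × rank (P ∪ ⁅ x ⁆) ≡ rank P)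
  spanned? P x = (x ∈? E) ×-dec (rank (P ∪ ⁅ x ⁆) ℕ.≟ rank P)

  closure : Subset m → Subset m
  closure P = Vec.tabulate (does ∘ spanned? P)

  ∈-closure⁺ : ∀ {P x} → x ∈ E → rank (P ∪ ⁅ x ⁆) ≡ rank P → x ∈ closure P
  ∈-closure⁺ {P} {x} x∈E eq = Vec.lookup⇒[]= x (closure P)
    (trans (Vec.lookup∘tabulate (does ∘ spanned? P) x) (dec-true (spanned? P x) (x∈E , eq)))

  ∈-closure⁻ : ∀ {P x} → x ∈ closure P → x ∈ E × rank (P ∪ ⁅ x ⁆) ≡ rank P
  ∈-closure⁻ {P} {x} x∈ = lemma (spanned? P x)
    (trans (sym (Vec.lookup∘tabulate (does ∘ spanned? P) x)) (Vec.[]=⇒lookup x∈))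
    where
    lemma : ∀ {p} {X : Set p} (X? : Dec X) → does X? ≡ true → X
    lemma (yes x) _ = x

  module _ {P} (P⊆E : P ⊆ E) where

    ⊆-closure : P ⊆ closure P
    ⊆-closure {x} x∈P = ∈-closure⁺ (P⊆E x∈P)
      (cong rank (⊆-antisym (∪⁅⁆-⊆ id x∈P) (p⊆p∪q ⁅ x ⁆)))

    closure-⊆ : closure P ⊆ E
    closure-⊆ = proj₁ ∘ ∈-closure⁻ {P}

    rank-closure : rank (closure P) ≡ rank P
    rank-closure = ℕ.≤-antisym
      (subst (rank (closure P) ≤_)
             (rank-∪-spanned _ refl P⊆E closure-⊆ (proj₂ ∘ ∈-closure⁻ {P}))
             (monotone (q⊆p∪q P (closure P)) (∪-least P⊆E closure-⊆)))
      (monotone ⊆-closure closure-⊆)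

    closure-isFlat : IsFlat (closure P)
    closure-isFlat = closure-⊆ , λ x x∈E eq → ∈-closure⁺ x∈E (ℕ.≤-antisym
      (subst (rank (P ∪ ⁅ x ⁆) ≤_) (trans eq rank-closure)
        (monotone (∪-monoˡ ⁅ x ⁆ ⊆-closure) (∪⁅⁆-⊆ closure-⊆ x∈E)))
      (monotone (p⊆p∪q ⁅ x ⁆) (∪⁅⁆-⊆ P⊆E x∈E)))

    flat≡closure : ∀ {H} → IsFlat H → P ⊆ H → rank H ≡ rank P → H ≡ closure P
    flat≡closure {H} (H⊆E , closed) P⊆H rH≡rP = ⊆-antisym H⊆cl
      λ {x} x∈cl → closed x (closure-⊆ x∈cl) (ℕ.≤-antisym
        (subst (rank (H ∪ ⁅ x ⁆) ≤_) (trans rank-closure (sym rH≡rP))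
          (monotone (∪⁅⁆-⊆ H⊆cl x∈cl) closure-⊆))
        (monotone (p⊆p∪q ⁅ x ⁆) (∪⁅⁆-⊆ H⊆E (closure-⊆ x∈cl))))
      where
      H⊆cl : H ⊆ closure P
      H⊆cl {x} x∈H = ∈-closure⁺ (H⊆E x∈H) (ℕ.≤-antisym
        (subst (rank (P ∪ ⁅ x ⁆) ≤_) rH≡rP (monotone (∪⁅⁆-⊆ P⊆H x∈H) H⊆E))
        (monotone (p⊆p∪q ⁅ x ⁆) (∪⁅⁆-⊆ P⊆E (H⊆E x∈H))))

  copoints : List (Subset m)
  copoints = filter isCopoint? (allSubsets m)

  copoints-unique : Unique copoints
  copoints-unique = Unique.filter⁺ isCopoint? (allSubsets-unique m)

  ∈-copoints⁺ : ∀ {H} → IsCopoint H → H ∈ˡ copoints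
  ∈-copoints⁺ {H} = ∈-filter⁺ isCopoint? (∈-allSubsets H)

  ∈-copoints⁻ : ∀ {H} → H ∈ˡ copoints → IsCopoint H
  ∈-copoints⁻ H∈ = proj₂ (∈-filter⁻ isCopoint? {xs = allSubsets m} H∈)

  -- The induction needs a prefix `P`, and with it the condition `P ⊆ H` on the copoint. The
  -- geometry sits in the empty word: there `P` has rank one below the full rank, and `closure P` is
  -- the only copoint above it. Each letter merely exchanges the choice of an element with that of a
  -- copoint.
  ν-copoints : ∀ t {P} → P ⊆ E → suc (rank P + ones t) ≡ matroidRank →
    ν rank P (E ─ P) t ≡ ∑[ H ← copoints ] ⟦ P ⊆? H ⟧ * ν rank P (H ─ P) t
  ν-copoints [] {P} P⊆E r≡ = sym (trans
    (∑-single _ copoints-unique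
      (∈-copoints⁺ (closure-isFlat P⊆E , trans (cong suc (rank-closure P⊆E)) r≡′))
      λ {H} H∈ H≢ → let flat , rH≡ = ∈-copoints⁻ H∈ in
        trans (ℕ.*-identityʳ _) (⟦⟧-no (P ⊆? H) λ P⊆H →
          H≢ (flat≡closure P⊆E flat P⊆H (ℕ.suc-injective (trans rH≡ (sym r≡′))))))
    (trans (ℕ.*-identityʳ _) (⟦⟧-yes (P ⊆? closure P) (⊆-closure P⊆E))))
    where
    r≡′ : suc (rank P) ≡ matroidRank
    r≡′ = trans (cong suc (sym (ℕ.+-identityʳ (rank P)))) r≡
  ν-copoints (d ∷ t) {P} P⊆E r≡ = begin
    (∑[ x ← elements (E ─ P) ] [ x ] * ν rank (P ∪ ⁅ x ⁆) (E ─ P - x) t)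
      ≡⟨ ∑-cong (elements (E ─ P)) (λ {x} x∈ → trans
           (⟦⟧*-congʳ (step rank P x ℕ.≟ toℕ d) (λ eq → trans
              (cong (λ A → ν rank (P ∪ ⁅ x ⁆) A t) (p─q─r≡p─q∪r E P ⁅ x ⁆))
              (let x∈E = p─q⊆p E P (∈-elements⁻ (E ─ P) x∈) in
               ν-copoints t (∪⁅⁆-⊆ P⊆E x∈E) (trans (cong suc (begin
                 rank (P ∪ ⁅ x ⁆) + ones t  ≡⟨ cong (_+ ones t) (rank-step M P⊆E x∈E eq) ⟩
                 rank P + toℕ d + ones t    ≡⟨ ℕ.+-assoc (rank P) _ _ ⟩
                 rank P + (toℕ d + ones t)  ≡⟨ cong (rank P +_) (ones-∷ d t) ⟨
                 rank P + ones (d ∷ t)      ∎)) r≡))))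
           (sym (∑-*ˡ copoints [ x ] _))) ⟩
    (∑[ x ← elements (E ─ P) ] ∑[ H ← copoints ] [ x ] * (⟦ P ∪ ⁅ x ⁆ ⊆? H ⟧ * N x H))
      ≡⟨ ∑-swap (elements (E ─ P)) copoints _ ⟩
    (∑[ H ← copoints ] ∑[ x ← elements (E ─ P) ] [ x ] * (⟦ P ∪ ⁅ x ⁆ ⊆? H ⟧ * N x H))
      ≡⟨ ∑-cong copoints (λ {H} H∈ → let H⊆E = proj₁ (proj₁ (∈-copoints⁻ H∈)) in begin
           (∑[ x ← elements (E ─ P) ] [ x ] * (⟦ P ∪ ⁅ x ⁆ ⊆? H ⟧ * N x H))
             ≡⟨ ∑-elements (E ─ P) _ ⟩
           (∑[ x ← allFin m ] ⟦ x ∈? E ─ P ⟧ * ([ x ] * (⟦ P ∪ ⁅ x ⁆ ⊆? H ⟧ * N x H)))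
             ≡⟨ ∑-cong (allFin m) (λ {x} _ → regroup H⊆E x) ⟩
           (∑[ x ← allFin m ] ⟦ P ⊆? H ⟧ * (⟦ x ∈? H ─ P ⟧ * ([ x ] * N x H)))
             ≡⟨ ∑-*ˡ (allFin m) ⟦ P ⊆? H ⟧ _ ⟩
           ⟦ P ⊆? H ⟧ * (∑[ x ← allFin m ] ⟦ x ∈? H ─ P ⟧ * ([ x ] * N x H))
             ≡⟨ cong (⟦ P ⊆? H ⟧ *_) (∑-elements (H ─ P) _) ⟨
           ⟦ P ⊆? H ⟧ * (∑[ x ← elements (H ─ P) ] [ x ] * N x H)
             ≡⟨ cong (⟦ P ⊆? H ⟧ *_) (∑-cong (elements (H ─ P)) λ {x} _ →
                  cong (λ A → [ x ] * ν rank (P ∪ ⁅ x ⁆) A t) (sym (p─q─r≡p─q∪r H P ⁅ x ⁆))) ⟩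
           ⟦ P ⊆? H ⟧ * ν rank P (H ─ P) (d ∷ t) ∎) ⟩
    (∑[ H ← copoints ] ⟦ P ⊆? H ⟧ * ν rank P (H ─ P) (d ∷ t)) ∎
    where
    open ≡-Reasoning
    [_] : Fin m → ℕ
    [ x ] = ⟦ step rank P x ℕ.≟ toℕ d ⟧
    N : Fin m → Subset m → ℕ
    N x H = ν rank (P ∪ ⁅ x ⁆) (H ─ (P ∪ ⁅ x ⁆)) t
    regroup : ∀ {H} → H ⊆ E → ∀ x →
              ⟦ x ∈? E ─ P ⟧ * ([ x ] * (⟦ P ∪ ⁅ x ⁆ ⊆? H ⟧ * N x H)) ≡
              ⟦ P ⊆? H ⟧ * (⟦ x ∈? H ─ P ⟧ * ([ x ] * N x H))
    regroup {H} H⊆E x = begin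
      ⟦ x ∈? E ─ P ⟧ * ([ x ] * (⟦ P ∪ ⁅ x ⁆ ⊆? H ⟧ * N x H))
        ≡⟨ solve 4 (λ a b c d → a :* (b :* (c :* d)) := a :* c :* (b :* d)) refl
             ⟦ x ∈? E ─ P ⟧ [ x ] ⟦ P ∪ ⁅ x ⁆ ⊆? H ⟧ (N x H) ⟩
      ⟦ x ∈? E ─ P ⟧ * ⟦ P ∪ ⁅ x ⁆ ⊆? H ⟧ * ([ x ] * N x H)
        ≡⟨ cong (_* ([ x ] * N x H)) (trans (sym (⟦⟧-× (x ∈? E ─ P) (P ∪ ⁅ x ⁆ ⊆? H)))
             (trans (⟦⟧-cong ((x ∈? E ─ P) ×-dec (P ∪ ⁅ x ⁆ ⊆? H)) ((P ⊆? H) ×-dec (x ∈? H ─ P))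
               (λ (x∈ , Px⊆) → Px⊆ ∘ p⊆p∪q ⁅ x ⁆ ,
                 x∈p∧x∉q⇒x∈p─q (∪⁅⁆-⊆⁻ {P = P} Px⊆) (x∈p─q⇒x∉q E P x∈))
               (λ (P⊆ , x∈) → let x∈H = p─q⊆p H P x∈ in
                 x∈p∧x∉q⇒x∈p─q (H⊆E x∈H) (x∈p─q⇒x∉q H P x∈) , ∪⁅⁆-⊆ P⊆ x∈H))
             (⟦⟧-× (P ⊆? H) (x ∈? H ─ P)))) ⟩
      ⟦ P ⊆? H ⟧ * ⟦ x ∈? H ─ P ⟧ * ([ x ] * N x H)   ≡⟨ ℕ.*-assoc ⟦ P ⊆? H ⟧ _ _ ⟩
      ⟦ P ⊆? H ⟧ * (⟦ x ∈? H ─ P ⟧ * ([ x ] * N x H)) ∎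
      where open +-*-Solver using (solve; _:*_; _:=_)

  ν-copoints-E : ∀ t → suc (ones t) ≡ matroidRank →
                 ν rank ⊥ E t ≡ ∑[ H ← copoints ] ν rank ⊥ H t
  ν-copoints-E t r≡ = begin
    ν rank ⊥ E t       ≡⟨ cong (λ A → ν rank ⊥ A t) (p─⊥≡p E) ⟨
    ν rank ⊥ (E ─ ⊥) t ≡⟨ ν-copoints t ⊥⊆ (trans (cong (λ k → suc (k + ones t)) (rank-⊥ M)) r≡) ⟩
    (∑[ H ← copoints ] ⟦ ⊥ ⊆? H ⟧ * ν rank ⊥ (H ─ ⊥) t)
      ≡⟨ ∑-cong copoints (λ {H} _ → trans
           (cong₂ (λ k A → k * ν rank ⊥ A t) (⟦⟧-yes (⊥ ⊆? H) ⊥⊆) (p─⊥≡p H))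
           (ℕ.*-identityˡ _)) ⟩
    (∑[ H ← copoints ] ν rank ⊥ H t) ∎
    where open ≡-Reasoning

  -- The sum over the deck of the coefficients at `t`. Only the size of an entry is tested; for an
  -- entry of the right size but the wrong rank, `ν` vanishes by `rank-mismatch`.
  deckCoefficient : Word → ℕ
  deckCoefficient t = ∑[ H ← copoints ] ⟦ ∣ H ∣ ℕ.≟ length t ⟧ * ν rank ⊥ H t

  -- Padding t with j zeros exposes only the copoints of size ∣t∣ + j, each
  -- with the factor j !; so the copoints have to be separated by size.

  sizeShare : Word → ℕ → ℕ
  sizeShare t j = ∑[ H ← copoints ] ⟦ ∣ H ∣ ℕ.≟ length t + j ⟧ * ν rank ⊥ H t

  -- A copoint `H` contributes at the single index `j = ∣ H ∣ ∸ length t`, or nowhere if it is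
  -- smaller than `t`. The bound `B` is left free so that two matroids can be compared over the same
  -- range of `j`.
  ν-shares : ∀ t B → m < B → suc (ones t) ≡ matroidRank →
             ν rank ⊥ E t ≡ ∑[ j ← upTo B ] sizeShare t j
  ν-shares t B m<B r≡ = begin
    ν rank ⊥ E t                     ≡⟨ ν-copoints-E t r≡ ⟩
    (∑[ H ← copoints ] ν rank ⊥ H t) ≡⟨ ∑-cong copoints (λ {H} _ → split H) ⟩
    (∑[ H ← copoints ] ∑[ j ← upTo B ] ⟦ ∣ H ∣ ℕ.≟ length t + j ⟧ * ν rank ⊥ H t)
      ≡⟨ ∑-swap copoints (upTo B) _ ⟩
    (∑[ j ← upTo B ] sizeShare t j)  ∎
    where
    open ≡-Reasoning
    split : ∀ H → ν rank ⊥ H t ≡ ∑[ j ← upTo B ] ⟦ ∣ H ∣ ℕ.≟ length t + j ⟧ * ν rank ⊥ H t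
    split H with length t ℕ.≤? ∣ H ∣
    ... | no ∣t∣≰∣H∣ = let ν≡0 = ν-long rank ⊥ H t (ℕ.≰⇒> ∣t∣≰∣H∣) in
      trans ν≡0 (sym (∑-zero (upTo B) λ {j} _ →
        trans (cong (⟦ ∣ H ∣ ℕ.≟ length t + j ⟧ *_) ν≡0) (ℕ.*-zeroʳ ⟦ ∣ H ∣ ℕ.≟ length t + j ⟧)))
    ... | yes ∣t∣≤∣H∣ = sym (trans
      (∑-single _ (Unique.upTo⁺ B)
        (∈-upTo⁺ (ℕ.≤-<-trans (ℕ.m∸n≤m ∣ H ∣ (length t)) (ℕ.≤-<-trans (∣p∣≤n H) m<B)))
        (λ {j} _ j≢ → cong (_* ν rank ⊥ H t) (⟦⟧-no (∣ H ∣ ℕ.≟ length t + j) λ eq →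
          j≢ (trans (sym (ℕ.m+n∸m≡n (length t) j)) (cong (_∸ length t) (sym eq))))))
      (trans (cong (_* ν rank ⊥ H t)
               (⟦⟧-yes (∣ H ∣ ℕ.≟ length t + (∣ H ∣ ∸ length t)) (sym (ℕ.m+[n∸m]≡n ∣t∣≤∣H∣))))
             (ℕ.*-identityˡ _)))

  deckCoefficient-zeros : ∀ t j → suc (ones t) ≡ matroidRank →
    deckCoefficient (t ++ replicate j 0F) ≡ j ! * sizeShare t j
  deckCoefficient-zeros t j r≡ = trans
    (∑-cong copoints λ {H} H∈ → let (H⊆E , _) , rH≡ = ∈-copoints⁻ H∈ in begin
      ⟦ ∣ H ∣ ℕ.≟ length t0 ⟧ * ν rank ⊥ H t0
        ≡⟨ cong (λ k → ⟦ ∣ H ∣ ℕ.≟ k ⟧ * ν rank ⊥ H t0) length-t0 ⟩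
      ⟦ ∣ H ∣ ℕ.≟ length t + j ⟧ * ν rank ⊥ H t0
        ≡⟨ ⟦⟧*-congʳ (∣ H ∣ ℕ.≟ length t + j) (λ eq →
             trailing-zeros (profile (restrict M _ H⊆E)) j t
               (ℕ.suc-injective (trans r≡ (sym rH≡))) (sym eq)) ⟩
      ⟦ ∣ H ∣ ℕ.≟ length t + j ⟧ * (j ! * ν rank ⊥ H t)
        ≡⟨ *-exchange ⟦ ∣ H ∣ ℕ.≟ length t + j ⟧ (j !) _ ⟩
      j ! * (⟦ ∣ H ∣ ℕ.≟ length t + j ⟧ * ν rank ⊥ H t) ∎)
    (∑-*ˡ copoints (j !) _)
    where
    open ≡-Reasoning
    t0 : Word
    t0 = t ++ replicate j 0F
    length-t0 : length t0 ≡ length t + j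
    length-t0 = trans (length-++ t) (cong (length t +_) (length-replicate j))

-- Rank, size and counts from the deck coefficients

module _ {m′} (M : Matroid m) (N : Matroid m′)
         (2≤r : 2 ≤ Matroid.matroidRank M)
         (D≡ : ∀ t → deckCoefficient M t ≡ deckCoefficient N t) where

  private
    module M = Matroid M
    module N = Matroid N

    k : ℕ
    k = M.matroidRank ∸ 1

    rM≡ : suc k ≡ M.matroidRank
    rM≡ = ℕ.m+[n∸m]≡n (ℕ.≤-trans (s≤s z≤n) 2≤r)

  -- If the ranks differed, no entry of the deck of `N` would have a nonzero coefficient at a word
  -- with one 1 fewer than the rank of `M`. By equality of the coefficients all counts of `M` at
  -- such words would be 0, contradicting `profile-nonzero`. This includes an empty deck of `N`.
  deck-rank : M.matroidRank ≡ N.matroidRank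
  deck-rank with M.matroidRank ℕ.≟ N.matroidRank
  ... | yes eq = eq
  ... | no r≢  = contradiction (λ t ones≡ → let r≡ = trans (cong suc ones≡) rM≡ in trans
      (ν-shares M t (suc m) ℕ.≤-refl r≡)
      (∑-zero (upTo (suc m)) λ {j} _ → share≡0 t j r≡))
    (profile-nonzero k (profile M) (ℕ.≤-reflexive rM≡))
    where
    deck≡0 : ∀ t → suc (ones t) ≡ M.matroidRank → deckCoefficient N t ≡ 0
    deck≡0 t r≡ = ∑-zero (copoints N) λ {H} H∈ → let (H⊆E , _) , rH≡ = ∈-copoints⁻ N H∈ in trans
      (⟦⟧*-congʳ (∣ H ∣ ℕ.≟ length t) λ eq →
        Profile.rank-mismatch (profile (restrict N H H⊆E)) t (sym eq)
          λ ones≡ → r≢ (trans (sym r≡) (trans (cong suc ones≡) rH≡)))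
      (ℕ.*-zeroʳ ⟦ ∣ H ∣ ℕ.≟ length t ⟧)
    ones-zeros : ∀ t j → ones (t ++ replicate j 0F) ≡ ones t
    ones-zeros []      zero    = refl
    ones-zeros []      (suc j) = ones-zeros [] j
    ones-zeros (d ∷ t) j       = trans (ones-∷ d (t ++ replicate j 0F))
      (trans (cong (toℕ d +_) (ones-zeros t j)) (sym (ones-∷ d t)))
    share≡0 : ∀ t j → suc (ones t) ≡ M.matroidRank → sizeShare M t j ≡ 0
    share≡0 t j r≡ = ℕ.*-cancelˡ-≡ _ _ (j !) {{j ℕ.!≢0}} (begin
      j ! * sizeShare M t j                      ≡⟨ deckCoefficient-zeros M t j r≡ ⟨
      deckCoefficient M (t ++ replicate j 0F)    ≡⟨ D≡ (t ++ replicate j 0F) ⟩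
      deckCoefficient N (t ++ replicate j 0F)
        ≡⟨ deck≡0 (t ++ replicate j 0F) (trans (cong suc (ones-zeros t j)) r≡) ⟩
      0                                          ≡⟨ ℕ.*-zeroʳ (j !) ⟨
      j ! * 0                                    ∎)
      where open ≡-Reasoning

  private
    rN≡ : suc k ≡ N.matroidRank
    rN≡ = trans rM≡ deck-rank

    profileM : Profile M.size (suc k) (ν M.rank ⊥ M.E)
    profileM = subst (λ r → Profile M.size r (ν M.rank ⊥ M.E)) (sym rM≡) (profile M)

    profileN : Profile N.size (suc k) (ν N.rank ⊥ N.E)
    profileN = subst (λ r → Profile N.size r (ν N.rank ⊥ N.E)) (sym rN≡) (profile N)

    agree : AgreeAt k (ν M.rank ⊥ M.E) (ν N.rank ⊥ N.E)
    agree t ones≡ = begin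
      ν M.rank ⊥ M.E t                  ≡⟨ ν-shares M t B (s≤s (ℕ.m≤m+n m m′)) rM ⟩
      (∑[ j ← upTo B ] sizeShare M t j) ≡⟨ ∑-cong (upTo B) (λ {j} _ → share j) ⟩
      (∑[ j ← upTo B ] sizeShare N t j) ≡⟨ ν-shares N t B (s≤s (ℕ.m≤n+m m′ m)) rN ⟨
      ν N.rank ⊥ N.E t                  ∎
      where
      open ≡-Reasoning
      B : ℕ
      B = suc (m + m′)
      rM : suc (ones t) ≡ M.matroidRank
      rM = trans (cong suc ones≡) rM≡
      rN : suc (ones t) ≡ N.matroidRank
      rN = trans (cong suc ones≡) rN≡
      share : ∀ j → sizeShare M t j ≡ sizeShare N t j
      share j = ℕ.*-cancelˡ-≡ _ _ (j !) {{j ℕ.!≢0}} (begin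
        j ! * sizeShare M t j                   ≡⟨ deckCoefficient-zeros M t j rM ⟨
        deckCoefficient M (t ++ replicate j 0F) ≡⟨ D≡ (t ++ replicate j 0F) ⟩
        deckCoefficient N (t ++ replicate j 0F) ≡⟨ deckCoefficient-zeros N t j rN ⟩
        j ! * sizeShare N t j                   ∎)

    0<k : 0 < k
    0<k = s<s⁻¹ (subst (2 ≤_) (sym rM≡) 2≤r)

  deck-size : M.size ≡ N.size
  deck-size = profile-size profileM profileN 0<k agree

  deck-ν : ∀ t → ones t ≡ M.matroidRank → ν M.rank ⊥ M.E t ≡ ν N.rank ⊥ N.E t
  deck-ν t ones≡ = profile-agree profileM profileN 0<k agree t (trans ones≡ (sym rM≡))

-- Duality

∣p─q∣+∣q∣≡∣p∣ : {p q : Subset m} → q ⊆ p → ∣ p ─ q ∣ + ∣ q ∣ ≡ ∣ p ∣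
∣p─q∣+∣q∣≡∣p∣ {p = []}          {[]}          _   = refl
∣p─q∣+∣q∣≡∣p∣ {p = outside ∷ p} {outside ∷ q} q⊆p = ∣p─q∣+∣q∣≡∣p∣ (drop-∷-⊆ q⊆p)
∣p─q∣+∣q∣≡∣p∣ {p = inside ∷ p}  {outside ∷ q} q⊆p = cong suc (∣p─q∣+∣q∣≡∣p∣ (drop-∷-⊆ q⊆p))
∣p─q∣+∣q∣≡∣p∣ {p = inside ∷ p}  {inside ∷ q}  q⊆p =
  trans (ℕ.+-suc ∣ p ─ q ∣ ∣ q ∣) (cong suc (∣p─q∣+∣q∣≡∣p∣ (drop-∷-⊆ q⊆p)))
∣p─q∣+∣q∣≡∣p∣ {p = outside ∷ p} {inside ∷ q}  q⊆p = contradiction (q⊆p here) λ ()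

∣p∪q∣+∣p∩q∣≡∣p∣+∣q∣ : (p q : Subset m) → ∣ p ∪ q ∣ + ∣ p ∩ q ∣ ≡ ∣ p ∣ + ∣ q ∣
∣p∪q∣+∣p∩q∣≡∣p∣+∣q∣ []            []            = refl
∣p∪q∣+∣p∩q∣≡∣p∣+∣q∣ (outside ∷ p) (outside ∷ q) = ∣p∪q∣+∣p∩q∣≡∣p∣+∣q∣ p q
∣p∪q∣+∣p∩q∣≡∣p∣+∣q∣ (inside ∷ p)  (outside ∷ q) = cong suc (∣p∪q∣+∣p∩q∣≡∣p∣+∣q∣ p q)
∣p∪q∣+∣p∩q∣≡∣p∣+∣q∣ (outside ∷ p) (inside ∷ q)  =
  trans (cong suc (∣p∪q∣+∣p∩q∣≡∣p∣+∣q∣ p q)) (sym (ℕ.+-suc ∣ p ∣ ∣ q ∣))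
∣p∪q∣+∣p∩q∣≡∣p∣+∣q∣ (inside ∷ p)  (inside ∷ q)  = cong suc
  (trans (ℕ.+-suc ∣ p ∪ q ∣ ∣ p ∩ q ∣)
    (trans (cong suc (∣p∪q∣+∣p∩q∣≡∣p∣+∣q∣ p q)) (sym (ℕ.+-suc ∣ p ∣ ∣ q ∣))))

∉─⇒∈ : ∀ {p q : Subset m} {x} → x ∈ p → x ∉ p ─ q → x ∈ q
∉─⇒∈ {q = q} {x} x∈p x∉ = decidable-stable (x ∈? q) (x∉ ∘ x∈p∧x∉q⇒x∈p─q x∈p)

─-antitone : ∀ (p : Subset m) {q r} → q ⊆ r → p ─ r ⊆ p ─ q
─-antitone p {r = r} q⊆r x∈ = x∈p∧x∉q⇒x∈p─q (p─q⊆p p r x∈) (x∈p─q⇒x∉q p r x∈ ∘ q⊆r)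

p─[p─q]≡q : ∀ {p q : Subset m} → q ⊆ p → p ─ (p ─ q) ≡ q
p─[p─q]≡q {p = p} {q} q⊆p = ⊆-antisym
  (λ x∈ → ∉─⇒∈ (p─q⊆p p (p ─ q) x∈) (x∈p─q⇒x∉q p (p ─ q) x∈))
  (λ x∈q → x∈p∧x∉q⇒x∈p─q (q⊆p x∈q) λ x∈ → x∈p─q⇒x∉q p q x∈ x∈q)

p∪[q─p]≡q : ∀ {p q : Subset m} → p ⊆ q → p ∪ (q ─ p) ≡ q
p∪[q─p]≡q {p = p} {q} p⊆q = ⊆-antisym (∪-least p⊆q (p─q⊆p q p)) q⊆
  where
  q⊆ : q ⊆ p ∪ (q ─ p)
  q⊆ {x} x∈q with x ∈? p
  ... | yes x∈p = p⊆p∪q (q ─ p) x∈p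
  ... | no x∉p  = q⊆p∪q p (q ─ p) (x∈p∧x∉q⇒x∈p─q x∈q x∉p)

─∪-∪ : ∀ {p q r : Subset m} → r ⊆ p → (∀ {x} → x ∈ r → x ∉ q) → (p ─ (q ∪ r)) ∪ r ≡ p ─ q
─∪-∪ {p = p} {q} {r} r⊆p disjoint = ⊆-antisym
  (∪-least (─-antitone p (p⊆p∪q r)) (λ x∈r → x∈p∧x∉q⇒x∈p─q (r⊆p x∈r) (disjoint x∈r)))
  ⊇
  where
  ⊇ : p ─ q ⊆ (p ─ (q ∪ r)) ∪ r
  ⊇ {x} x∈ with x ∈? r
  ... | yes x∈r = q⊆p∪q (p ─ (q ∪ r)) r x∈r
  ... | no x∉r  = p⊆p∪q r (x∈p∧x∉q⇒x∈p─q (p─q⊆p p q x∈)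
                    ([ x∈p─q⇒x∉q p q x∈ , x∉r ]′ ∘ x∈p∪q⁻ q r))

p─q∪x≡p─[q-x] : ∀ {p q : Subset m} {x} → q ⊆ p → x ∈ q → (p ─ q) ∪ ⁅ x ⁆ ≡ p ─ (q - x)
p─q∪x≡p─[q-x] {p = p} {q} {x} q⊆p x∈q = ⊆-antisym
  (∪⁅⁆-⊆ (─-antitone p (p─q⊆p q ⁅ x ⁆))
         (x∈p∧x∉q⇒x∈p─q (q⊆p x∈q) λ x∈ → x∈p─q⇒x∉q q ⁅ x ⁆ x∈ (x∈⁅x⁆ x)))
  ⊇
  where
  ⊇ : p ─ (q - x) ⊆ (p ─ q) ∪ ⁅ x ⁆
  ⊇ {y} y∈ with y Fin.≟ x
  ... | yes refl = q⊆p∪q (p ─ q) ⁅ x ⁆ (x∈⁅x⁆ x)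
  ... | no y≢x   = p⊆p∪q ⁅ x ⁆ (x∈p∧x∉q⇒x∈p─q (p─q⊆p p (q - x) y∈)
                     λ y∈q → x∈p─q⇒x∉q p (q - x) y∈ (x∈p∧x≢y⇒x∈p-y y∈q y≢x))

-- The dual matroid

rank-≤-extension : (M : Matroid m) → let open Matroid M in
                   ∀ {X Y} → X ⊆ Y → Y ⊆ E → rank Y ≤ rank X + ∣ Y ─ X ∣
rank-≤-extension M {X} {Y} X⊆Y Y⊆E = begin
  rank Y                                  ≡⟨ cong rank (p∪[q─p]≡q X⊆Y) ⟨
  rank (X ∪ (Y ─ X))                      ≤⟨ ℕ.m≤m+n _ _ ⟩
  rank (X ∪ (Y ─ X)) + rank (X ∩ (Y ─ X)) ≤⟨ submodular (Y⊆E ∘ X⊆Y) Y─X⊆E ⟩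
  rank X + rank (Y ─ X)                   ≤⟨ ℕ.+-monoʳ-≤ (rank X) (rank≤size Y─X⊆E) ⟩
  rank X + ∣ Y ─ X ∣                      ∎
  where
  open ℕ.≤-Reasoning
  open Matroid M
  Y─X⊆E : Y ─ X ⊆ E
  Y─X⊆E = Y⊆E ∘ p─q⊆p Y X

-- The rank function of the dual. For `A ⊆ E` the subtraction does not truncate, and `corank-+`
-- gives the additive form in which coranks are compared.
corank : Matroid m → Subset m → ℕ
corank M A = ∣ A ∣ + rank (E ─ A) ∸ rank E
  where open Matroid M

corank-+ : (M : Matroid m) → let open Matroid M in
           ∀ {A} → A ⊆ E → corank M A + rank E ≡ ∣ A ∣ + rank (E ─ A)
corank-+ M {A} A⊆E = ℕ.m∸n+n≡m (begin
  rank E                            ≤⟨ rank-≤-extension M (p─q⊆p E A) id ⟩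
  rank (E ─ A) + ∣ E ─ (E ─ A) ∣    ≡⟨ cong (λ B → rank (E ─ A) + ∣ B ∣) (p─[p─q]≡q A⊆E) ⟩
  rank (E ─ A) + ∣ A ∣              ≡⟨ ℕ.+-comm (rank (E ─ A)) ∣ A ∣ ⟩
  ∣ A ∣ + rank (E ─ A)              ∎)
  where
  open ℕ.≤-Reasoning
  open Matroid M

dual : Matroid m → Matroid m
dual M = record
  { E          = E
  ; rank       = corank M
  ; rank≤size  = λ {A} A⊆E → ℕ.+-cancelʳ-≤ (rank E) _ _ (begin
      corank M A + rank E   ≡⟨ corank-+ M A⊆E ⟩
      ∣ A ∣ + rank (E ─ A)  ≤⟨ ℕ.+-monoʳ-≤ ∣ A ∣ (monotone (p─q⊆p E A) id) ⟩
      ∣ A ∣ + rank E        ∎)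
  ; monotone   = λ {A} {B} A⊆B B⊆E → ℕ.∸-monoˡ-≤ (rank E) (begin
      ∣ A ∣ + rank (E ─ A)
        ≤⟨ ℕ.+-monoʳ-≤ ∣ A ∣ (rank-≤-extension M (─-antitone E A⊆B) (p─q⊆p E A)) ⟩
      ∣ A ∣ + (rank (E ─ B) + ∣ (E ─ A) ─ (E ─ B) ∣)
        ≤⟨ ℕ.+-monoʳ-≤ ∣ A ∣ (ℕ.+-monoʳ-≤ (rank (E ─ B)) (p⊆q⇒∣p∣≤∣q∣ (difference A B))) ⟩
      ∣ A ∣ + (rank (E ─ B) + ∣ B ─ A ∣)
        ≡⟨ solve 3 (λ a r b → a :+ (r :+ b) := b :+ a :+ r) refl
             (∣ A ∣) (rank (E ─ B)) (∣ B ─ A ∣) ⟩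
      ∣ B ─ A ∣ + ∣ A ∣ + rank (E ─ B) ≡⟨ cong (_+ rank (E ─ B)) (∣p─q∣+∣q∣≡∣p∣ A⊆B) ⟩
      ∣ B ∣ + rank (E ─ B) ∎)
  ; submodular = λ {A} {B} A⊆E B⊆E → ℕ.+-cancelʳ-≤ (rank E + rank E) _ _ (begin
      corank M (A ∪ B) + corank M (A ∩ B) + (rank E + rank E)
        ≡⟨ interchange (corank M (A ∪ B)) _ (rank E) (rank E) ⟩
      (corank M (A ∪ B) + rank E) + (corank M (A ∩ B) + rank E)
        ≡⟨ cong₂ _+_ (corank-+ M (∪-least A⊆E B⊆E)) (corank-+ M (A⊆E ∘ p∩q⊆p A B)) ⟩
      (∣ A ∪ B ∣ + rank (E ─ (A ∪ B))) + (∣ A ∩ B ∣ + rank (E ─ (A ∩ B)))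
        ≡⟨ interchange (∣ A ∪ B ∣) _ (∣ A ∩ B ∣) _ ⟩
      (∣ A ∪ B ∣ + ∣ A ∩ B ∣) + (rank (E ─ (A ∪ B)) + rank (E ─ (A ∩ B)))
        ≤⟨ ℕ.+-mono-≤ (ℕ.≤-reflexive (∣p∪q∣+∣p∩q∣≡∣p∣+∣q∣ A B)) (begin
             rank (E ─ (A ∪ B)) + rank (E ─ (A ∩ B))
               ≤⟨ ℕ.+-mono-≤
                    (monotone (λ x∈ → x∈p∩q⁺ (─-antitone E (p⊆p∪q B) x∈ ,
                                              ─-antitone E (q⊆p∪q A B) x∈))
                              (p─q⊆p E A ∘ p∩q⊆p _ _))
                    (monotone (E─∩⊆ A B) (∪-least (p─q⊆p E A) (p─q⊆p E B))) ⟩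
             rank ((E ─ A) ∩ (E ─ B)) + rank ((E ─ A) ∪ (E ─ B))
               ≡⟨ ℕ.+-comm (rank ((E ─ A) ∩ (E ─ B))) _ ⟩
             rank ((E ─ A) ∪ (E ─ B)) + rank ((E ─ A) ∩ (E ─ B))
               ≤⟨ submodular (p─q⊆p E A) (p─q⊆p E B) ⟩
             rank (E ─ A) + rank (E ─ B) ∎) ⟩
      (∣ A ∣ + ∣ B ∣) + (rank (E ─ A) + rank (E ─ B))
        ≡⟨ interchange (∣ A ∣) (∣ B ∣) (rank (E ─ A)) _ ⟩
      (∣ A ∣ + rank (E ─ A)) + (∣ B ∣ + rank (E ─ B))
        ≡⟨ cong₂ _+_ (corank-+ M A⊆E) (corank-+ M B⊆E) ⟨
      (corank M A + rank E) + (corank M B + rank E)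
        ≡⟨ interchange (corank M A) (rank E) (corank M B) (rank E) ⟩
      corank M A + corank M B + (rank E + rank E) ∎)
  }
  where
  open ℕ.≤-Reasoning
  open +-*-Solver using (solve; _:+_; _:=_)
  open Matroid M
  difference : ∀ A B → (E ─ A) ─ (E ─ B) ⊆ B ─ A
  difference A B x∈ = let x∈E─A = p─q⊆p (E ─ A) (E ─ B) x∈ in
    x∈p∧x∉q⇒x∈p─q (∉─⇒∈ (p─q⊆p E A x∈E─A) (x∈p─q⇒x∉q (E ─ A) (E ─ B) x∈)) (x∈p─q⇒x∉q E A x∈E─A)
  E─∩⊆ : ∀ A B → E ─ (A ∩ B) ⊆ (E ─ A) ∪ (E ─ B)
  E─∩⊆ A B {x} x∈ with x ∈? A
  ... | no x∉A  = p⊆p∪q (E ─ B) (x∈p∧x∉q⇒x∈p─q (p─q⊆p E (A ∩ B) x∈) x∉A)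
  ... | yes x∈A = q⊆p∪q (E ─ A) (E ─ B) (x∈p∧x∉q⇒x∈p─q (p─q⊆p E (A ∩ B) x∈)
                    λ x∈B → x∈p─q⇒x∉q E (A ∩ B) x∈ (x∈p∩q⁺ (x∈A , x∈B)))

-- Reversing an ordering of E exchanges the increments 0 and 1 between M and
-- its dual.

dualWord : Word → Word
dualWord []      = []
dualWord (d ∷ t) = dualWord t ∷ʳ opposite d

length-dualWord : ∀ t → length (dualWord t) ≡ length t
length-dualWord []      = refl
length-dualWord (d ∷ t) = trans (length-∷ʳ (dualWord t) _) (cong suc (length-dualWord t))

ones-dualWord : ∀ t → ones (dualWord t) + ones t ≡ length t
ones-dualWord []      = refl
ones-dualWord (d ∷ t) = begin
  ones (dualWord t ∷ʳ opposite d) + ones (d ∷ t)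
    ≡⟨ cong₂ _+_ (ones-∷ʳ (dualWord t) (opposite d)) (trans (ones-∷ d t) (ℕ.+-comm (toℕ d) _)) ⟩
  (ones (dualWord t) + toℕ (opposite d)) + (ones t + toℕ d)
    ≡⟨ interchange (ones (dualWord t)) _ (ones t) _ ⟩
  (ones (dualWord t) + ones t) + (toℕ (opposite d) + toℕ d)
    ≡⟨ cong₂ _+_ (ones-dualWord t) (digits+ d) ⟩
  length t + 1  ≡⟨ ℕ.+-comm (length t) 1 ⟩
  suc (length t) ∎
  where
  open ≡-Reasoning
  digits+ : ∀ (d : Fin 2) → toℕ (opposite d) + toℕ d ≡ 1
  digits+ 0F = refl
  digits+ 1F = refl

dualWord-∷ʳ : ∀ t d → dualWord (t ∷ʳ d) ≡ opposite d ∷ dualWord t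
dualWord-∷ʳ []      d = refl
dualWord-∷ʳ (e ∷ t) d = cong (_∷ʳ opposite e) (dualWord-∷ʳ t d)

dualWord-involutive : ∀ t → dualWord (dualWord t) ≡ t
dualWord-involutive []      = refl
dualWord-involutive (d ∷ t) = trans (dualWord-∷ʳ (dualWord t) (opposite d))
  (cong₂ _∷_ (Fin.opposite-involutive d) (dualWord-involutive t))

⟦⟧-opposite : ∀ a b (d : Fin 2) → a + b ≡ 1 → ⟦ b ℕ.≟ toℕ (opposite d) ⟧ ≡ ⟦ a ℕ.≟ toℕ d ⟧
⟦⟧-opposite 0 1 0F refl = refl
⟦⟧-opposite 0 1 1F refl = refl
⟦⟧-opposite 1 0 0F refl = refl
⟦⟧-opposite 1 0 1F refl = refl

module _ (M : Matroid m) where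

  open Matroid M

  corank-─ : ∀ {P} → P ⊆ E → corank M (E ─ P) + rank E ≡ ∣ E ─ P ∣ + rank P
  corank-─ {P} P⊆E = trans (corank-+ M (p─q⊆p E P))
    (cong (λ A → ∣ E ─ P ∣ + rank A) (p─[p─q]≡q P⊆E))

  -- Moving `x` from the complement into `P` lowers `∣ E ─ P ∣` by one and raises `rank P` by 0 or
  -- 1; by `corank-─` the corank of the complement drops by the difference. So exactly one of the
  -- two steps is 1.
  step-dual : ∀ {P x} → P ⊆ E → x ∈ E → x ∉ P →
              step rank P x + (corank M (E ─ P) ∸ corank M (E ─ (P ∪ ⁅ x ⁆))) ≡ 1
  step-dual {P} {x} P⊆E x∈E x∉P = arithmetic (corank M (E ─ P)) (corank M (E ─ (P ∪ ⁅ x ⁆)))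
    (monotone (p⊆p∪q ⁅ x ⁆) Px⊆E) (unit-increase M P x Px⊆E)
    (trans (corank-─ P⊆E) (cong (_+ rank P) (trans
      (size-remove (E ─ P) (x∈p∧x∉q⇒x∈p─q x∈E x∉P))
      (cong (suc ∘ ∣_∣) (p─q─r≡p─q∪r E P ⁅ x ⁆)))))
    (corank-─ Px⊆E)
    where
    Px⊆E : P ∪ ⁅ x ⁆ ⊆ E
    Px⊆E = ∪⁅⁆-⊆ P⊆E x∈E
    -- `u` and `v` are the ranks before and after adding `x`, `a` and `b` the coranks of the
    -- complements, `r` is `rank E`, and `w` the size of the smaller complement.
    arithmetic : ∀ {u v} a b {r w} → u ≤ v → v ≤ suc u → a + r ≡ suc w + u → b + r ≡ w + v →
                 (v ∸ u) + (a ∸ b) ≡ 1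
    arithmetic {u} {v} a b {r} {w} u≤v v≤1+u a+r b+r with ℕ.m≤n⇒m<n∨m≡n u≤v
    ... | inj₂ refl = begin
      (u ∸ u) + (a ∸ b) ≡⟨ cong₂ (λ i j → i + (j ∸ b)) (ℕ.n∸n≡0 u) a≡1+b ⟩
      suc b ∸ b         ≡⟨ ℕ.m+n∸n≡m 1 b ⟩
      1                 ∎
      where
      open ≡-Reasoning
      a≡1+b : a ≡ suc b
      a≡1+b = ℕ.+-cancelʳ-≡ r _ _ (trans a+r (cong suc (sym b+r)))
    ... | inj₁ u<v with refl ← ℕ.≤-antisym v≤1+u u<v = begin
      (suc u ∸ u) + (a ∸ b) ≡⟨ cong₂ (λ i j → i + (j ∸ b)) (ℕ.m+n∸n≡m 1 u) a≡b ⟩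
      suc (b ∸ b)           ≡⟨ cong suc (ℕ.n∸n≡0 b) ⟩
      1                     ∎
      where
      open ≡-Reasoning
      a≡b : a ≡ b
      a≡b = ℕ.+-cancelʳ-≡ r _ _ (trans a+r (trans (sym (ℕ.+-suc w u)) (sym b+r)))

  -- Reading `S` backwards starts from the complement of `P ∪ S` and ends at that of `P`. The first
  -- letter of `t` is the last one of `dualWord t`, hence `ν-∷ʳ` and the condition that `t` exhaust
  -- `S`; `step-dual` matches the letters.
  ν-dual : ∀ t {P S} → P ⊆ E → S ⊆ E → (∀ {x} → x ∈ S → x ∉ P) → ∣ S ∣ ≡ length t →
           ν (corank M) (E ─ (P ∪ S)) S (dualWord t) ≡ ν rank P S t
  ν-dual []      P⊆E S⊆E disjoint ∣S∣≡ = refl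
  ν-dual (d ∷ t) {P} {S} P⊆E S⊆E disjoint ∣S∣≡ = trans
    (ν-∷ʳ (corank M) (E ─ (P ∪ S)) S (dualWord t) (opposite d)
      (trans ∣S∣≡ (cong suc (sym (length-dualWord t)))))
    (∑-cong (elements S) λ {x} x∈ → term (∈-elements⁻ S x∈))
    where
    open ≡-Reasoning
    term : ∀ {x} → x ∈ S →
      ⟦ corank M ((E ─ (P ∪ S)) ∪ S) ∸ corank M ((E ─ (P ∪ S)) ∪ (S - x)) ℕ.≟ toℕ (opposite d) ⟧
        * ν (corank M) (E ─ (P ∪ S)) (S - x) (dualWord t) ≡
      ⟦ step rank P x ℕ.≟ toℕ d ⟧ * ν rank (P ∪ ⁅ x ⁆) (S - x) t
    term {x} x∈S = cong₂ _*_
      (trans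
        (cong₂ (λ A B → ⟦ corank M A ∸ corank M B ℕ.≟ toℕ (opposite d) ⟧)
          (─∪-∪ S⊆E disjoint)
          (trans (cong (λ A → (E ─ A) ∪ (S - x)) (sym (move-element P S x∈S)))
                 (─∪-∪ (S⊆E ∘ S-x⊆S) disjoint′)))
        (⟦⟧-opposite (step rank P x) (corank M (E ─ P) ∸ corank M (E ─ (P ∪ ⁅ x ⁆))) d
          (step-dual P⊆E (S⊆E x∈S) (disjoint x∈S))))
      (trans
        (cong (λ A → ν (corank M) (E ─ A) (S - x) (dualWord t)) (sym (move-element P S x∈S)))
        (ν-dual t (∪⁅⁆-⊆ P⊆E (S⊆E x∈S)) (S⊆E ∘ S-x⊆S) disjoint′
          (ℕ.suc-injective (trans (sym (size-remove S x∈S)) ∣S∣≡))))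
      where
      S-x⊆S : S - x ⊆ S
      S-x⊆S = p─q⊆p S ⁅ x ⁆
      disjoint′ : ∀ {y} → y ∈ S - x → y ∉ P ∪ ⁅ x ⁆
      disjoint′ y∈ = [ disjoint (S-x⊆S y∈) , x∈p─q⇒x∉q S ⁅ x ⁆ y∈ ]′ ∘ x∈p∪q⁻ P ⁅ x ⁆

  -- With `ν-contract` this is `(M/P)* = M*|(E − P)` at the level of counts: the prefix `P` on the
  -- right plays the contracted set.
  ν-dual-─ : ∀ t {P} → P ⊆ E → ∣ E ─ P ∣ ≡ length t →
             ν (corank M) ⊥ (E ─ P) (dualWord t) ≡ ν rank P (E ─ P) t
  ν-dual-─ t {P} P⊆E len = trans
    (cong (λ A → ν (corank M) A (E ─ P) (dualWord t)) (sym (trans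
      (cong (E ─_) (p∪[q─p]≡q P⊆E))
      (Empty-unique λ (x , x∈) → x∈p─q⇒x∉q E E x∈ (p─q⊆p E E x∈)))))
    (ν-dual t P⊆E (p─q⊆p E P) (x∈p─q⇒x∉q E P) len)

  -- Contracting `Y` amounts to placing `Y` before everything else, since the constant `rank Y`
  -- cancels from every increment.
  ν-contract : ∀ t {P S Y} → Y ⊆ E → P ∪ S ⊆ E →
               ν (λ A → rank (A ∪ Y) ∸ rank Y) P S t ≡ ν rank (P ∪ Y) S t
  ν-contract []      Y⊆E PS⊆E = refl
  ν-contract (d ∷ t) {P} {S} {Y} Y⊆E PS⊆E = ∑-cong (elements S) λ {x} x∈ →
    let x∈S = ∈-elements⁻ S x∈ in cong₂ (λ k n → ⟦ k ℕ.≟ toℕ d ⟧ * n)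
      (begin
        (rank ((P ∪ ⁅ x ⁆) ∪ Y) ∸ rank Y) ∸ (rank (P ∪ Y) ∸ rank Y)
          ≡⟨ ℕ.∸-+-assoc (rank ((P ∪ ⁅ x ⁆) ∪ Y)) (rank Y) _ ⟩
        rank ((P ∪ ⁅ x ⁆) ∪ Y) ∸ (rank Y + (rank (P ∪ Y) ∸ rank Y))
          ≡⟨ cong₂ (λ A k → rank A ∸ k) (∪-exchange ⁅ x ⁆)
               (ℕ.m+[n∸m]≡n (monotone (q⊆p∪q P Y) (∪-least (PS⊆E ∘ p⊆p∪q S) Y⊆E))) ⟩
        rank ((P ∪ Y) ∪ ⁅ x ⁆) ∸ rank (P ∪ Y) ∎)
      (trans (ν-contract t Y⊆E (PS⊆E ∘ subst (_ ∈_) (move-element P S x∈S)))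
             (cong (λ A → ν rank A (S - x) t) (∪-exchange ⁅ x ⁆)))
    where
    open ≡-Reasoning
    ∪-exchange : ∀ X → (P ∪ X) ∪ Y ≡ (P ∪ Y) ∪ X
    ∪-exchange X = trans (∪-assoc P X Y) (trans (cong (P ∪_) (∪-comm X Y)) (sym (∪-assoc P Y X)))

  rank-dual : corank M E + rank E ≡ size
  rank-dual = begin
    corank M E + rank E   ≡⟨ corank-+ M id ⟩
    ∣ E ∣ + rank (E ─ E)
      ≡⟨ cong (λ A → ∣ E ∣ + rank A) (Empty-unique λ (x , x∈) → x∈p─q⇒x∉q E E x∈ (p─q⊆p E E x∈)) ⟩
    ∣ E ∣ + rank ⊥        ≡⟨ cong (∣ E ∣ +_) (rank-⊥ M) ⟩
    ∣ E ∣ + 0             ≡⟨ ℕ.+-identityʳ ∣ E ∣ ⟩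
    ∣ E ∣                 ∎
    where open ≡-Reasoning

  -- Circuits as complements of copoints of the dual

  independent-⊆ : ∀ {A B} → A ⊆ B → Independent B → Independent A
  independent-⊆ {A} {B} A⊆B (B⊆E , rB≡) = B⊆E ∘ A⊆B , ℕ.≤-antisym (rank≤size (B⊆E ∘ A⊆B))
    (ℕ.+-cancelʳ-≤ ∣ B ─ A ∣ _ _ (begin
      ∣ A ∣ + ∣ B ─ A ∣  ≡⟨ ℕ.+-comm ∣ A ∣ _ ⟩
      ∣ B ─ A ∣ + ∣ A ∣  ≡⟨ ∣p─q∣+∣q∣≡∣p∣ A⊆B ⟩
      ∣ B ∣              ≡⟨ rB≡ ⟨
      rank B             ≤⟨ rank-≤-extension M A⊆B B⊆E ⟩
      rank A + ∣ B ─ A ∣ ∎))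
    where open ℕ.≤-Reasoning

  module _ {Y : Subset m} (Y⊆E : Y ⊆ E) where

    -- Compared with `corank-─` at `Y`, this turns flatness of `E ─ Y` in the dual into the
    -- condition that deleting any single element of `Y` preserves its rank.
    corank-∪⁅⁆ : ∀ {x} → x ∈ Y →
                 corank M ((E ─ Y) ∪ ⁅ x ⁆) + rank E ≡ suc ∣ E ─ Y ∣ + rank (Y - x)
    corank-∪⁅⁆ {x} x∈Y = begin
      corank M ((E ─ Y) ∪ ⁅ x ⁆) + rank E
        ≡⟨ cong (λ A → corank M A + rank E) (p─q∪x≡p─[q-x] Y⊆E x∈Y) ⟩
      corank M (E ─ (Y - x)) + rank E  ≡⟨ corank-─ (Y⊆E ∘ Y-x⊆Y) ⟩
      ∣ E ─ (Y - x) ∣ + rank (Y - x)   ≡⟨ cong (_+ rank (Y - x)) size≡ ⟩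
      suc ∣ E ─ Y ∣ + rank (Y - x)     ∎
      where
      open ≡-Reasoning
      Y-x⊆Y : Y - x ⊆ Y
      Y-x⊆Y = p─q⊆p Y ⁅ x ⁆
      size≡ : ∣ E ─ (Y - x) ∣ ≡ suc ∣ E ─ Y ∣
      size≡ = ℕ.+-cancelʳ-≡ ∣ Y - x ∣ _ _ (begin
        ∣ E ─ (Y - x) ∣ + ∣ Y - x ∣  ≡⟨ ∣p─q∣+∣q∣≡∣p∣ (Y⊆E ∘ Y-x⊆Y) ⟩
        ∣ E ∣                        ≡⟨ ∣p─q∣+∣q∣≡∣p∣ Y⊆E ⟨
        ∣ E ─ Y ∣ + ∣ Y ∣            ≡⟨ cong (∣ E ─ Y ∣ +_) (size-remove Y x∈Y) ⟩
        ∣ E ─ Y ∣ + suc ∣ Y - x ∣    ≡⟨ ℕ.+-suc ∣ E ─ Y ∣ _ ⟩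
        suc ∣ E ─ Y ∣ + ∣ Y - x ∣    ∎)

    corank-E : ∣ E ─ Y ∣ + ∣ Y ∣ ≡ corank M E + rank E
    corank-E = trans (∣p─q∣+∣q∣≡∣p∣ Y⊆E) (sym rank-dual)

    -- For a circuit both `rank Y` and `rank (Y - x)` equal `∣ Y ∣ − 1`. The first value gives
    -- `E ─ Y` its corank, and the equality of the two makes it closed.
    circuit⇒copoint : IsCircuit Y → Matroid.IsCopoint (dual M) (E ─ Y)
    circuit⇒copoint (_ , dependent , minimal) = (p─q⊆p E Y , closed) ,
      ℕ.+-cancelʳ-≡ (rank E) _ _ (begin
        suc (corank M (E ─ Y) + rank E) ≡⟨ cong suc (corank-─ Y⊆E) ⟩
        suc (∣ E ─ Y ∣ + rank Y)        ≡⟨ ℕ.+-suc ∣ E ─ Y ∣ _ ⟨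
        ∣ E ─ Y ∣ + suc (rank Y)        ≡⟨ cong (∣ E ─ Y ∣ +_) rank-Y ⟩
        ∣ E ─ Y ∣ + ∣ Y ∣               ≡⟨ corank-E ⟩
        corank M E + rank E             ∎)
      where
      open ≡-Reasoning
      rank-Y-x : ∀ {x} → x ∈ Y → suc (rank (Y - x)) ≡ ∣ Y ∣
      rank-Y-x {x} x∈Y = trans (cong suc (proj₂ (minimal (Y - x) (x∈p⇒p-x⊂p x∈Y))))
                               (sym (size-remove Y x∈Y))
      rank-Y : suc (rank Y) ≡ ∣ Y ∣
      rank-Y with nonempty? Y
      ... | no empty = ⊥-elim (dependent
        (Y⊆E , trans (cong rank Y≡⊥) (trans (rank-⊥ M) (sym (trans (cong ∣_∣ Y≡⊥) (∣⊥∣≡0 m))))))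
        where
        Y≡⊥ : Y ≡ ⊥
        Y≡⊥ = Empty-unique empty
      ... | yes (x , x∈Y) = ℕ.≤-antisym
        (ℕ.≤∧≢⇒< (rank≤size Y⊆E) (λ eq → dependent (Y⊆E , eq)))
        (subst (_≤ suc (rank Y)) (rank-Y-x x∈Y) (s≤s (monotone (p─q⊆p Y ⁅ x ⁆) Y⊆E)))
      closed : ∀ x → x ∈ E → corank M ((E ─ Y) ∪ ⁅ x ⁆) ≡ corank M (E ─ Y) → x ∈ E ─ Y
      closed x x∈E eq = x∈p∧x∉q⇒x∈p─q x∈E λ x∈Y → dependent (Y⊆E , trans
        (ℕ.+-cancelˡ-≡ ∣ E ─ Y ∣ _ _ (begin
          ∣ E ─ Y ∣ + rank Y                   ≡⟨ corank-─ Y⊆E ⟨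
          corank M (E ─ Y) + rank E            ≡⟨ cong (_+ rank E) eq ⟨
          corank M ((E ─ Y) ∪ ⁅ x ⁆) + rank E  ≡⟨ corank-∪⁅⁆ x∈Y ⟩
          suc ∣ E ─ Y ∣ + rank (Y - x)         ≡⟨ ℕ.+-suc ∣ E ─ Y ∣ _ ⟨
          ∣ E ─ Y ∣ + suc (rank (Y - x))       ∎))
        (rank-Y-x x∈Y))

    -- The corank of `E ─ Y` forces `rank Y` to be `∣ Y ∣ − 1`, so `Y` is dependent. Closedness
    -- keeps the rank when an `x` is deleted, so each `Y - x` is independent, and a proper subset of
    -- `Y` lies in some `Y - x`.
    copoint⇒circuit : Matroid.IsCopoint (dual M) (E ─ Y) → IsCircuit Y
    copoint⇒circuit ((_ , closed) , r≡) = Y⊆E ,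
      (λ (_ , eq) → ℕ.1+n≢n (trans rank-Y (sym eq))) ,
      λ Z (Z⊆Y , x , x∈Y , x∉Z) → independent-⊆
        (λ z∈Z → x∈p∧x≢y⇒x∈p-y (Z⊆Y z∈Z) λ { refl → x∉Z z∈Z })
        (Y-x-independent x∈Y)
      where
      open ≡-Reasoning
      rank-Y : suc (rank Y) ≡ ∣ Y ∣
      rank-Y = ℕ.+-cancelˡ-≡ ∣ E ─ Y ∣ _ _ (begin
        ∣ E ─ Y ∣ + suc (rank Y)        ≡⟨ ℕ.+-suc ∣ E ─ Y ∣ _ ⟩
        suc (∣ E ─ Y ∣ + rank Y)        ≡⟨ cong suc (corank-─ Y⊆E) ⟨
        suc (corank M (E ─ Y)) + rank E ≡⟨ cong (_+ rank E) r≡ ⟩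
        corank M E + rank E             ≡⟨ corank-E ⟨
        ∣ E ─ Y ∣ + ∣ Y ∣               ∎)
      Y-x-independent : ∀ {x} → x ∈ Y → Independent (Y - x)
      Y-x-independent {x} x∈Y = Y-x⊆E , ℕ.≤-antisym (rank≤size Y-x⊆E)
        (subst (_≤ rank (Y - x)) (ℕ.suc-injective (trans rank-Y (size-remove Y x∈Y)))
          (ℕ.≮⇒≥ λ r< → x∈p─q⇒x∉q E Y (closed x (Y⊆E x∈Y) (same-corank r<)) x∈Y))
        where
        Y-x⊆E : Y - x ⊆ E
        Y-x⊆E = Y⊆E ∘ p─q⊆p Y ⁅ x ⁆
        Y≡ : (Y - x) ∪ ⁅ x ⁆ ≡ Y
        Y≡ = trans (∪-comm (Y - x) ⁅ x ⁆)
          (p∪[q─p]≡q λ y∈ → subst (_∈ Y) (sym (x∈⁅y⁆⇒x≡y x y∈)) x∈Y)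
        same-corank : rank (Y - x) < rank Y → corank M ((E ─ Y) ∪ ⁅ x ⁆) ≡ corank M (E ─ Y)
        same-corank r< = ℕ.+-cancelʳ-≡ (rank E) _ _ (begin
          corank M ((E ─ Y) ∪ ⁅ x ⁆) + rank E ≡⟨ corank-∪⁅⁆ x∈Y ⟩
          suc ∣ E ─ Y ∣ + rank (Y - x)        ≡⟨ ℕ.+-suc ∣ E ─ Y ∣ _ ⟨
          ∣ E ─ Y ∣ + suc (rank (Y - x))      ≡⟨ cong (∣ E ─ Y ∣ +_) (ℕ.≤-antisym r<
            (subst (λ A → rank A ≤ suc (rank (Y - x))) Y≡
              (unit-increase M (Y - x) x (subst (_⊆ E) (sym Y≡) Y⊆E)))) ⟩
          ∣ E ─ Y ∣ + rank Y                  ≡⟨ corank-─ Y⊆E ⟨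
          corank M (E ─ Y) + rank E           ∎)

  circuits : List (Subset m)
  circuits = filter isCircuit? (allSubsets m)

  ∑-circuits : ∀ (f : Subset m → ℕ) → (∑[ Y ← circuits ] f (E ─ Y)) ≡ ∑ (copoints (dual M)) f
  ∑-circuits f = ∑-reindex (Vec.≡-dec Bool._≟_)
    (Unique.filter⁺ isCircuit? (allSubsets-unique m)) (copoints-unique (dual M))
    (λ Y∈ → ∈-copoints⁺ (dual M) (circuit⇒copoint (⊆E Y∈) (∈-circuits⁻ Y∈)))
    (λ {H} H∈ → let H⊆E = proj₁ (proj₁ (∈-copoints⁻ (dual M) H∈)) in
      ∈-filter⁺ isCircuit? (∈-allSubsets (E ─ H)) (copoint⇒circuit (p─q⊆p E H)
        (subst (Matroid.IsCopoint (dual M)) (sym (p─[p─q]≡q H⊆E)) (∈-copoints⁻ (dual M) H∈))))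
    (p─[p─q]≡q ∘ ⊆E)
    (λ H∈ → p─[p─q]≡q (proj₁ (proj₁ (∈-copoints⁻ (dual M) H∈))))
    f
    where
    ∈-circuits⁻ : ∀ {Y} → Y ∈ˡ circuits → IsCircuit Y
    ∈-circuits⁻ Y∈ = proj₂ (∈-filter⁻ isCircuit? {xs = allSubsets m} Y∈)
    ⊆E : ∀ {Y} → Y ∈ˡ circuits → Y ⊆ E
    ⊆E = proj₁ ∘ ∈-circuits⁻

  circuitCoefficient : Word → ℕ
  circuitCoefficient t = ∑[ Y ← circuits ]
    ⟦ ∣ E ─ Y ∣ ℕ.≟ length t ⟧ * ν (λ A → rank (A ∪ Y) ∸ rank Y) ⊥ (E ─ Y) t

  -- The circuit deck replaces the copoint deck of the dual through its coefficients alone. The size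
  -- test supplies the equality of lengths that reversal requires.
  deckCoefficient-dual : ∀ t → deckCoefficient (dual M) t ≡ circuitCoefficient (dualWord t)
  deckCoefficient-dual t = trans
    (sym (∑-circuits λ H → ⟦ ∣ H ∣ ℕ.≟ length t ⟧ * ν (corank M) ⊥ H t))
    (∑-cong circuits λ {Y} Y∈ →
      let Y⊆E = proj₁ (proj₂ (∈-filter⁻ isCircuit? {xs = allSubsets m} Y∈)) in begin
      ⟦ ∣ E ─ Y ∣ ℕ.≟ length t ⟧ * ν (corank M) ⊥ (E ─ Y) t
        ≡⟨ cong₂ (λ k u → ⟦ ∣ E ─ Y ∣ ℕ.≟ k ⟧ * ν (corank M) ⊥ (E ─ Y) u)
             (sym (length-dualWord t)) (sym (dualWord-involutive t)) ⟩
      ⟦ ∣ E ─ Y ∣ ℕ.≟ length (dualWord t) ⟧ * ν (corank M) ⊥ (E ─ Y) (dualWord (dualWord t))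
        ≡⟨ ⟦⟧*-congʳ (∣ E ─ Y ∣ ℕ.≟ length (dualWord t)) (λ len → begin
             ν (corank M) ⊥ (E ─ Y) (dualWord (dualWord t)) ≡⟨ ν-dual-─ (dualWord t) Y⊆E len ⟩
             ν rank Y (E ─ Y) (dualWord t)
               ≡⟨ cong (λ A → ν rank A (E ─ Y) (dualWord t)) (∪-identityˡ Y) ⟨
             ν rank (⊥ ∪ Y) (E ─ Y) (dualWord t)
               ≡⟨ ν-contract (dualWord t) Y⊆E (∪-least ⊥⊆ (p─q⊆p E Y)) ⟨
             ν (λ A → rank (A ∪ Y) ∸ rank Y) ⊥ (E ─ Y) (dualWord t) ∎) ⟩
      ⟦ ∣ E ─ Y ∣ ℕ.≟ length (dualWord t) ⟧
        * ν (λ A → rank (A ∪ Y) ∸ rank Y) ⊥ (E ─ Y) (dualWord t) ∎)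
    where open ≡-Reasoning

  ν-dual-E : ∀ t → length t ≡ size → ν (corank M) ⊥ E (dualWord t) ≡ ν rank ⊥ E t
  ν-dual-E t len = subst (λ A → ν (corank M) ⊥ A (dualWord t) ≡ ν rank ⊥ A t) (p─⊥≡p E)
    (ν-dual-─ t ⊥⊆ (trans (cong ∣_∣ (p─⊥≡p E)) (sym len)))

-- Coefficients of decks

word : Symbol n r → Word
word s = Vec.toList (Symbol.bits s)

digits-word : (s : Symbol n r) → digits s ≡ map toℕ (word s)
digits-word s = Vec.toList-map toℕ (Symbol.bits s)

length-word : (s : Symbol n r) → length (word s) ≡ n
length-word s = Vec.length-toList (Symbol.bits s)

ones-word : (s : Symbol n r) → ones (word s) ≡ r
ones-word (symbol bits refl) = ones-toList bits
  where
  ones-toList : ∀ {n} (bits : Vec.Vec (Fin 2) n) →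
                ones (Vec.toList bits) ≡ Vec.count (Fin._≟ 1F) bits
  ones-toList []         = refl
  ones-toList (0F ∷ bits) = ones-toList bits
  ones-toList (1F ∷ bits) = cong suc (ones-toList bits)

toSymbol : ∀ t → length t ≡ n → ones t ≡ r → Symbol n r
toSymbol t refl refl = symbol (Vec.fromList t) refl

word-toSymbol : ∀ t (len : length t ≡ n) (ones≡ : ones t ≡ r) → word (toSymbol t len ones≡) ≡ t
word-toSymbol t refl refl = Vec.toList∘fromList t

module DeckCoefficients {c ℓ₁ ℓ₂} (K : HeytingField c ℓ₁ ℓ₂) (char0 : CharacteristicZero K) where

  open Invariant K
  private
    R : CommutativeRing c ℓ₁
    R = HeytingCommutativeRing.commutativeRing (HeytingField.heytingCommutativeRing K)
    module K = CommutativeRing R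
    open Mult K.+-monoid using (×-homo-+) renaming (_×_ to _·_)

  embed : ℕ → K.Carrier
  embed n = n · K.1#

  -- Characteristic zero enters here: equal sums in the field come from equal counts.
  embed-injective : ∀ a b → embed a K.≈ embed b → a ≡ b
  embed-injective zero    zero    _  = refl
  embed-injective zero    (suc b) eq = contradiction (K.sym eq) (char0 b)
  embed-injective (suc a) zero    eq = contradiction eq (char0 a)
  embed-injective (suc a) (suc b) eq = cong suc (embed-injective a b
    (GroupProperties.∙-cancelˡ K.+-group K.1# (embed a) (embed b) eq))

  embed-≡ : ∀ {a b} → a ≡ b → embed a K.≈ embed b
  embed-≡ = K.reflexive ∘ cong embed

  𝒢-invariant-ν : (M : Matroid m) (s : Symbol (Matroid.size M) (Matroid.matroidRank M)) →
    𝒢-invariant M s K.≈ embed (ν (Matroid.rank M) ⊥ (Matroid.E M) (word s))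
  𝒢-invariant-ν {m} M s = K.trans (coefficient (orderings E)) (embed-≡ (trans
    (cong₂ (λ l k → ∑[ π ← arrangements k E ] ⟦ ≡-dec ℕ._≟_ (rankSequence M π) l ⟧)
      (digits-word s) (sym (length-word s)))
    (∑-arrangements rank ⊥ E (word s))))
    where
    open Matroid M
    indicator : ∀ l → [ l ] s K.≈ embed ⟦ ≡-dec ℕ._≟_ l (digits s) ⟧
    indicator l with does (≡-dec ℕ._≟_ l (digits s))
    ... | true  = K.sym (K.+-identityʳ K.1#)
    ... | false = K.refl
    coefficient : ∀ πs → foldr _+𝒢_ 0𝒢 (map ([_] ∘ rankSequence M) πs) s K.≈
                  embed (∑[ π ← πs ] ⟦ ≡-dec ℕ._≟_ (rankSequence M π) (digits s) ⟧)
    coefficient []       = K.refl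
    coefficient (π ∷ πs) = K.trans (K.+-cong (indicator (rankSequence M π)) (coefficient πs))
      (K.sym (×-homo-+ K.1# ⟦ ≡-dec ℕ._≟_ (rankSequence M π) (digits s) ⟧ _))

  𝒢≈ : ∀ {m′} (M : Matroid m) (N : Matroid m′) →
       Matroid.size M ≡ Matroid.size N → Matroid.matroidRank M ≡ Matroid.matroidRank N →
       (∀ t → length t ≡ Matroid.size M → ones t ≡ Matroid.matroidRank M →
         ν (Matroid.rank M) ⊥ (Matroid.E M) t ≡ ν (Matroid.rank N) ⊥ (Matroid.E N) t) →
       𝒢[ M ] ≈𝒢 𝒢[ N ]
  𝒢≈ M N size≡ rank≡ ν≡ = transport size≡ rank≡ λ s s′ ss′ → K.trans (𝒢-invariant-ν M s)
    (K.trans (embed-≡ (trans (ν≡ (word s) (length-word s) (ones-word s))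
                             (cong (ν (Matroid.rank N) ⊥ (Matroid.E N)) ss′)))
             (K.sym (𝒢-invariant-ν N s′)))
    where
    -- Coefficients in differently indexed spaces are compared at symbols with the same word; only
    -- after the indices have been identified can a single symbol serve on both sides.
    transport : ∀ {n r n′ r′} {f : 𝒢 n r} {g : 𝒢 n′ r′} → n ≡ n′ → r ≡ r′ →
                (∀ s s′ → word s ≡ word s′ → f s K.≈ g s′) → (n , r , f) ≈𝒢 (n′ , r′ , g)
    transport refl refl f≈g = pointwise λ s → f≈g s s refl

  -- Extended by 0 outside the space to which `t` belongs, so that one word can be evaluated on
  -- every entry of a deck of mixed sizes.
  coefficientAt : Word → ⋃𝒢 → K.Carrier
  coefficientAt t (n , r , f) with length t ℕ.≟ n | ones t ℕ.≟ r
  ... | yes len | yes ones≡ = f (toSymbol t len ones≡)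
  ... | _       | _         = K.0#

  coefficientAt-cong : ∀ t {g h} → g ≈𝒢 h → coefficientAt t g K.≈ coefficientAt t h
  coefficientAt-cong t {n , r , _} (pointwise f≈g) with length t ℕ.≟ n | ones t ℕ.≟ r
  ... | yes len | yes ones≡ = f≈g (toSymbol t len ones≡)
  ... | yes _   | no _      = K.refl
  ... | no _    | yes _     = K.refl
  ... | no _    | no _      = K.refl

  coefficientAt-𝒢 : ∀ t (M : Matroid m) → coefficientAt t 𝒢[ M ] K.≈
    embed (⟦ Matroid.size M ℕ.≟ length t ⟧ * ν (Matroid.rank M) ⊥ (Matroid.E M) t)
  coefficientAt-𝒢 t M with length t ℕ.≟ Matroid.size M | ones t ℕ.≟ Matroid.matroidRank M
  ... | yes len | yes ones≡ = K.trans (𝒢-invariant-ν M (toSymbol t len ones≡)) (embed-≡ (trans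
        (cong (ν rank ⊥ E) (word-toSymbol t len ones≡))
        (sym (trans (cong (_* ν rank ⊥ E t) (⟦⟧-yes (size ℕ.≟ length t) (sym len)))
                    (ℕ.*-identityˡ _)))))
    where open Matroid M
  ... | yes len | no ones≢  = embed-≡ (sym (trans
        (cong (⟦ size ℕ.≟ length t ⟧ *_) (Profile.rank-mismatch (profile M) t len ones≢))
        (ℕ.*-zeroʳ ⟦ size ℕ.≟ length t ⟧)))
    where open Matroid M
  ... | no len≢ | yes _ = embed-≡ (sym (cong (_* ν (Matroid.rank M) ⊥ (Matroid.E M) t)
        (⟦⟧-no (Matroid.size M ℕ.≟ length t) (len≢ ∘ sym))))
  ... | no len≢ | no _  = embed-≡ (sym (cong (_* ν (Matroid.rank M) ⊥ (Matroid.E M) t)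
        (⟦⟧-no (Matroid.size M ℕ.≟ length t) (len≢ ∘ sym))))

  deckSum : Word → List ⋃𝒢 → K.Carrier
  deckSum t = foldr K._+_ K.0# ∘ map (coefficientAt t)

  deckSum-↭ : ∀ t {gs hs} → gs ↭ hs → deckSum t gs K.≈ deckSum t hs
  deckSum-↭ t gs↭hs = Permutation.foldr-commMonoid K.setoid K.+-isCommutativeMonoid
    (Permutation.map⁺ ⋃𝒢-setoid K.setoid (coefficientAt-cong t) gs↭hs)

  -- Deck entries carry proofs that their subsets are copoints or circuits; the coefficients depend
  -- on the subsets alone, so the sum passes to the plain filtered list.
  deckSum-reduce : ∀ t {a p} {A : Set a} {P : Pred A p} (P? : Decidable P)
    {f : ∀ {x} → P x → ⋃𝒢} (φ : A → ℕ) →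
    (∀ {x} (px : P x) → coefficientAt t (f px) K.≈ embed (φ x)) →
    ∀ xs → deckSum t (reduce f (all-filter P? xs)) K.≈ embed (∑ (filter P? xs) φ)
  deckSum-reduce t P? φ f≈φ []       = K.refl
  deckSum-reduce t P? φ f≈φ (x ∷ xs) with P? x
  ... | true because [Px] = K.trans
          (K.+-cong (f≈φ (invert [Px])) (deckSum-reduce t P? φ f≈φ xs))
          (K.sym (×-homo-+ K.1# (φ x) _))
  ... | false because _   = deckSum-reduce t P? φ f≈φ xs

  copointDeck-coefficients : ∀ {m′} (M : Matroid m) (N : Matroid m′) →
    copointDeck M ↭ copointDeck N → ∀ t → deckCoefficient M t ≡ deckCoefficient N t
  copointDeck-coefficients M N M↭N t = embed-injective _ _
    (K.trans (K.sym (sum≈ M)) (K.trans (deckSum-↭ t M↭N) (sum≈ N)))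
    where
    sum≈ : ∀ {m} (M : Matroid m) → deckSum t (copointDeck M) K.≈ embed (deckCoefficient M t)
    sum≈ M = deckSum-reduce t (Matroid.isCopoint? M) _
      (λ {X} ((X⊆E , _) , _) → coefficientAt-𝒢 t (restrict M X X⊆E)) (allSubsets _)

  circuitDeck-coefficients : ∀ {m′} (M : Matroid m) (N : Matroid m′) →
    circuitDeck M ↭ circuitDeck N → ∀ t → circuitCoefficient M t ≡ circuitCoefficient N t
  circuitDeck-coefficients M N M↭N t = embed-injective _ _
    (K.trans (K.sym (sum≈ M)) (K.trans (deckSum-↭ t M↭N) (sum≈ N)))
    where
    sum≈ : ∀ {m} (M : Matroid m) → deckSum t (circuitDeck M) K.≈ embed (circuitCoefficient M t)
    sum≈ M = deckSum-reduce t (Matroid.isCircuit? M) _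
      (λ {Y} (Y⊆E , _) → coefficientAt-𝒢 t (contract M Y Y⊆E)) (allSubsets _)

-- The rank bounds exclude decks that do not show the size: in rank 1 the only copoint is the set of
-- loops, whatever the number of nonloops, and in rank 0 the deck is empty. The bound for circuits
-- says that the dual has rank at least 2.
theorem6p8 : ∀ {c ℓ₁ ℓ₂} (K : HeytingField c ℓ₁ ℓ₂) → CharacteristicZero K →
    let open Invariant K in
    ∀ {m} (M : Matroid m) →
    (2 ≤ Matroid.matroidRank M →
    ∀ {m′} (N : Matroid m′) →
    copointDeck M ↭ copointDeck N → 𝒢[ M ] ≈𝒢 𝒢[ N ])
    ×
    (Matroid.matroidRank M + 2 ≤ Matroid.size M →
    ∀ {m′} (N : Matroid m′) →
    circuitDeck M ↭ circuitDeck N → 𝒢[ M ] ≈𝒢 𝒢[ N ])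
theorem6p8 K char0 M = fromCopoints , fromCircuits
  where
  open Invariant K
  open DeckCoefficients K char0
  module M = Matroid M

  fromCopoints : 2 ≤ M.matroidRank → ∀ {m′} (N : Matroid m′) →
                 copointDeck M ↭ copointDeck N → 𝒢[ M ] ≈𝒢 𝒢[ N ]
  fromCopoints 2≤r N M↭N = 𝒢≈ M N (deck-size M N 2≤r D≡) (deck-rank M N 2≤r D≡)
    (λ t _ → deck-ν M N 2≤r D≡ t)
    where
    D≡ : ∀ t → deckCoefficient M t ≡ deckCoefficient N t
    D≡ = copointDeck-coefficients M N M↭N

  fromCircuits : M.matroidRank + 2 ≤ M.size → ∀ {m′} (N : Matroid m′) →
                 circuitDeck M ↭ circuitDeck N → 𝒢[ M ] ≈𝒢 𝒢[ N ]
  fromCircuits r+2≤n N M↭N = 𝒢≈ M N size≡ rank≡ λ t len ones≡ → begin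
    ν M.rank ⊥ M.E t                  ≡⟨ ν-dual-E M t len ⟨
    ν (corank M) ⊥ M.E (dualWord t)   ≡⟨ deck-ν (dual M) (dual N) 2≤r* D≡ (dualWord t)
      (ℕ.+-cancelʳ-≡ M.matroidRank _ _ (begin
        ones (dualWord t) + M.matroidRank ≡⟨ cong (ones (dualWord t) +_) ones≡ ⟨
        ones (dualWord t) + ones t        ≡⟨ ones-dualWord t ⟩
        length t                          ≡⟨ len ⟩
        M.size                            ≡⟨ rank-dual M ⟨
        corank M M.E + M.matroidRank      ∎)) ⟩
    ν (corank N) ⊥ N.E (dualWord t)   ≡⟨ ν-dual-E N t (trans len size≡) ⟩
    ν N.rank ⊥ N.E t                  ∎
    where
    open ≡-Reasoning
    module N = Matroid N
    2≤r* : 2 ≤ Matroid.matroidRank (dual M)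
    2≤r* = ℕ.+-cancelʳ-≤ M.matroidRank _ _
      (subst₂ _≤_ (ℕ.+-comm M.matroidRank 2) (sym (rank-dual M)) r+2≤n)
    D≡ : ∀ t → deckCoefficient (dual M) t ≡ deckCoefficient (dual N) t
    D≡ t = trans (deckCoefficient-dual M t) (trans
      (circuitDeck-coefficients M N M↭N (dualWord t)) (sym (deckCoefficient-dual N t)))
    size≡ : M.size ≡ N.size
    size≡ = deck-size (dual M) (dual N) 2≤r* D≡
    rank≡ : M.matroidRank ≡ N.matroidRank
    rank≡ = ℕ.+-cancelˡ-≡ (corank M M.E) _ _ (begin
      corank M M.E + M.matroidRank ≡⟨ rank-dual M ⟩
      M.size                       ≡⟨ size≡ ⟩
      N.size                       ≡⟨ rank-dual N ⟨
      corank N N.E + N.matroidRank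
        ≡⟨ cong (_+ N.matroidRank) (deck-rank (dual M) (dual N) 2≤r* D≡) ⟨
      corank M M.E + N.matroidRank ∎)
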